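{- Let $m\in\mathbb{N}$ and $A\subseteq\mathbb{N}^m$. The following two statements are equivalent. (1) There exist functions $\alpha:\mathcal{P}_f(\mathbb{N}^{\mathbb{N}})\to\mathbb{N}$ and $H:\mathcal{P}_f(\mathbb{N}^{\mathbb{N}})\to\mathcal{P}_f(\mathbb{N})$ such that (a) if $F,G\in\mathcal{P}_f(\mathbb{N}^{\mathbb{N}})$ and $F\subsetneq G$, then $\max H(F)<\min H(G)$; and (b) whenever $(G_i)_{i\in\mathbb{N}}$ is a sequence in $\mathcal{P}_f(\mathbb{N}^{\mathbb{N}})$ with $G_1\subsetneq G_2\subsetneq\cdots\subsetneq G_n\subsetneq\cdots$, then for all $\beta_1<\cdots<\beta_m$ in $\mathcal{P}_f(\mathbb{N})$ and all choices of $f_i\in G_i$ ($i\in\mathbb{N}$), one has $$\left(\sum_{i\in\beta_1}\Bigl(\alpha(G_i)+\sum_{t\in H(G_i)}f_i(t)\Bigr),\ldots,\sum_{i\in\beta_m}\Bigl(\alpha(G_i)+\sum_{t\in H(G_i)}f_i(t)\Bigr)\right)\in A.$$ (2) There exists an idempotent $p$ in $(\mathcal{J},+)$ such that $A\in\bigotimes_{i=1}^m p$.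
   Context: $\mathbb{N}$ is the set of positive integers; $\mathcal{P}_f(X)$ is the set of nonempty finite subsets of $X$; $\mathbb{N}^{\mathbb{N}}$ is the set of all functions $\mathbb{N}\to\mathbb{N}$. For $\beta,\gamma\in\mathcal{P}_f(\mathbb{N})$, $\beta<\gamma$ means $\max\beta<\min\gamma$. $\beta\mathbb{N}$ is the set of ultrafilters on $\mathbb{N}$, with the operation: $A\in p+q$ iff $\{x\in\mathbb{N}:-x+A\in q\}\in p$, where $-x+A=\{y\in\mathbb{N}:x+y\in A\}$. An ultrafilter $p$ is idempotent if $p+p=p$. A set $A\subseteq\mathbb{N}$ is a $J$-set if for every $F\in\mathcal{P}_f(\mathbb{N}^{\mathbb{N}})$ there exist $a\in\mathbb{N}$ and $\beta\in\mathcal{P}_f(\mathbb{N})$ such that $a+\sum_{t\in\beta}f(t)\in A$ for all $f\in F$. $\mathcal{J}=\{p\in\beta\mathbb{N}:\text{every }A\in p\text{ is a }J\text{ -set}\}$; it is a two-sided ideal of $(\beta\mathbb{N},+)$. Tensor products: for ultrafilters $p_1,\ldots,p_k$ on $\mathbb{N}$, $\bigotimes_{i=1}^k p_i$ is the ultrafilter on $\mathbb{N}^k$ defined recursively by $\bigotimes_{i=1}^1p_i=p_1$, and, for $A\subseteq\mathbb{N}^{k+1}$, $A\in\bigotimes_{i=1}^{k+1}p_i$ iff $\{(x_1,\ldots,x_k)\in\mathbb{N}^k:\{x_{k+1}\in\mathbb{N}:(x_1,\ldots,x_{k+1})\in A\}\in p_{k+1}\}\in\bigotimes_{i=1}^kp_i$.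 $\bigotimes_{i=1}^mp$ is the case $p_i=p$ for all $i$. -}

module Defs where

open import Data.Fin.Base using (Fin; inject₁; fromℕ)
open import Data.Irrelevant using ([_])
open import Data.List.NonEmpty.Base as List⁺ using (List⁺; toList; foldr₁)
import Data.List.Membership.Setoid as ListMembership
open import Data.List.Relation.Unary.Unique.Setoid using (Unique)
open import Data.Nat.Base as ℕ using (ℕ; zero; suc; NonZero; _<_; _⊔_; _⊓_)
open import Data.Product.Base using (Σ; ∃-syntax; _×_; _,_)
open import Data.Refinement.Base using (Refinement-syntax; _,_; value)
open import Data.Sum.Base using (_⊎_; inj₁; inj₂)
open import Data.Vec.Base as Vec using (Vec; _∷ʳ_)
open import Function.Base using (_∘_)
open import Level as Level using (0ℓ)
open import Relation.Binary.Bundles using (Setoid)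
open import Relation.Binary.Core using (REL)
open import Relation.Binary.Definitions using (_Respectsˡ_)
open import Relation.Binary.PropositionalEquality using (_≡_; setoid; _→-setoid_)
open import Relation.Nullary.Negation using (¬_)
open import Relation.Unary using (Pred; U; ∅; ∁; _∩_; _⊆_; _≐_)

-- Zermelo's axiom of choice. The content is that the choice function respects
-- the equality of S; without that clause the statement would hold trivially,
-- by projection from Σ. By Diaconescu's argument it implies excluded middle
-- for every P : Set.
AxiomOfChoice : Set₁
AxiomOfChoice =
  (S : Setoid 0ℓ 0ℓ) (B : Set) (let open Setoid S)
  (R : REL Carrier B 0ℓ) → R Respectsˡ _≈_ →
  (∀ x → ∃[ y ] R x y) →
  Σ (Carrier → B) λ f → (∀ {x x′} → x ≈ x′ → f x ≡ f x′) × (∀ x → R x (f x))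

ℕ⁺ : Set
ℕ⁺ = [ n ∈ ℕ ∣ NonZero n ]

infixl 6 _+⁺_

_+⁺_ : ℕ⁺ → ℕ⁺ → ℕ⁺
(m , [ m≢0 ]) +⁺ (n , _) = m ℕ.+ n , [ nonZero m n m≢0 ]
  where
  nonZero : ∀ m n → NonZero m → NonZero (m ℕ.+ n)
  nonZero (suc _) _ _ = _

1⁺ : ℕ⁺
1⁺ = 1 , [ _ ]

ℕ⁺-setoid : Setoid 0ℓ 0ℓ
ℕ⁺-setoid = setoid ℕ⁺

-- Functions ℕ⁺ → ℕ⁺ up to pointwise equality.
ℕ⁺^ℕ⁺ : Setoid 0ℓ 0ℓ
ℕ⁺^ℕ⁺ = ℕ⁺ →-setoid ℕ⁺

-- A nonempty finite subset is given by a nonempty list without repetitions;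
-- two lists with the same elements denote the same subset (see 𝒫f-setoid).
record 𝒫f (S : Setoid 0ℓ 0ℓ) : Set where
  constructor finset
  field
    elements : List⁺ (Setoid.Carrier S)
    distinct : Unique S (toList elements)

open 𝒫f public

module _ {S : Setoid 0ℓ 0ℓ} where

  open Setoid S using (Carrier)

  infix 4 _∈f_ _⊆f_ _⊊f_ _≈f_

  _∈f_ : Carrier → 𝒫f S → Set
  x ∈f F = ListMembership._∈_ S x (toList (elements F))

  _⊆f_ : 𝒫f S → 𝒫f S → Set
  F ⊆f G = ∀ {x} → x ∈f F → x ∈f G

  _⊊f_ : 𝒫f S → 𝒫f S → Set
  F ⊊f G = F ⊆f G × ¬ (G ⊆f F)

  _≈f_ : 𝒫f S → 𝒫f S → Set
  F ≈f G = F ⊆f G × G ⊆f F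

𝒫f-setoid : Setoid 0ℓ 0ℓ → Setoid 0ℓ 0ℓ
𝒫f-setoid S = record
  { Carrier       = 𝒫f S
  ; _≈_           = _≈f_
  ; isEquivalence = record
    { refl  = (λ p → p) , (λ p → p)
    ; sym   = λ (p , q) → (λ {x} → q {x}) , (λ {x} → p {x})
    ; trans = λ (p , q) (p′ , q′) → (λ x∈ → p′ (p x∈)) , (λ x∈ → q (q′ x∈))
    }
  }

max min : 𝒫f ℕ⁺-setoid → ℕ
max β = foldr₁ _⊔_ (List⁺.map value (elements β))
min β = foldr₁ _⊓_ (List⁺.map value (elements β))

infix 4 _<f_

_<f_ : 𝒫f ℕ⁺-setoid → 𝒫f ℕ⁺-setoid → Set
β <f γ = max β < min γ

∑ : 𝒫f ℕ⁺-setoid → (ℕ⁺ → ℕ⁺) → ℕ⁺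
∑ β f = foldr₁ _+⁺_ (List⁺.map f (elements β))

infix 5 ∑-syntax
∑-syntax = ∑
syntax ∑-syntax β (λ t → e) = ∑[ t ∈ β ] e

IsJSet : Pred (Pred ℕ⁺ 0ℓ) 0ℓ
IsJSet A = (F : 𝒫f ℕ⁺^ℕ⁺) →
  Σ ℕ⁺ λ a → Σ (𝒫f ℕ⁺-setoid) λ β → (∀ f → f ∈f F → A (a +⁺ (∑[ t ∈ β ] f t)))

record Ultrafilter (X : Set) : Set₁ where
  field
    family    : Pred (Pred X 0ℓ) 0ℓ
    whole     : family U
    proper    : ¬ family ∅
    upward    : ∀ {A B} → A ⊆ B → family A → family B
    intersect : ∀ {A B} → family A → family B → family (A ∩ B)
    ultra     : ∀ A → family A ⊎ family (∁ A)

open Ultrafilter public using (family)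

infix 4 _∈ᵘ_ _≈ᵘ_

_∈ᵘ_ : {X : Set} → Pred X 0ℓ → Ultrafilter X → Set
A ∈ᵘ p = family p A

_≈ᵘ_ : {X : Set} → Ultrafilter X → Ultrafilter X → Set₁
p ≈ᵘ q = family p ≐ family q

-- A belongs to the result iff { x ∣ { y ∣ g x y ∈ A } ∈ q } ∈ p.
combine : {X Y Z : Set} → (X → Y → Z) → Ultrafilter X → Ultrafilter Y → Ultrafilter Z
combine g p q = record
  { family    = λ A → (λ x → (λ y → A (g x y)) ∈ᵘ q) ∈ᵘ p
  ; whole     = P.upward (λ _ → Q.whole) P.whole
  ; proper    = P.proper ∘ P.upward Q.proper
  ; upward    = λ A⊆B → P.upward (Q.upward A⊆B)
  ; intersect = λ a b → P.upward (λ (u , v) → Q.intersect u v) (P.intersect a b)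
  ; ultra     = λ A → ultra′ A (P.ultra _)
  }
  where
  module P = Ultrafilter p
  module Q = Ultrafilter q

  inner : ∀ A → ¬ (A ∈ᵘ q) → ∁ A ∈ᵘ q
  inner A A∉q with Q.ultra A
  ... | inj₂ r = r
  ... | inj₁ r with () ← A∉q r

  ultra′ : ∀ A → let B = λ x → (λ y → A (g x y)) ∈ᵘ q in
           B ∈ᵘ p ⊎ ∁ B ∈ᵘ p →
           B ∈ᵘ p ⊎ (λ x → (λ y → ¬ A (g x y)) ∈ᵘ q) ∈ᵘ p
  ultra′ A (inj₁ r) = inj₁ r
  ultra′ A (inj₂ r) = inj₂ (P.upward (inner _) r)

βℕ : Set₁
βℕ = Ultrafilter ℕ⁺

infixl 6 _⊕_

_⊕_ : βℕ → βℕ → βℕ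
_⊕_ = combine _+⁺_

Idempotent : βℕ → Set₁
Idempotent p = p ⊕ p ≈ᵘ p

𝒥 : Pred βℕ (Level.suc 0ℓ)
𝒥 p = ∀ A → A ∈ᵘ p → IsJSet A

-- The family p is indexed by 0, …, k, so this is a product of k + 1 ultrafilters.
⨂ : ∀ {k} → (Fin (suc k) → βℕ) → Ultrafilter (Vec ℕ⁺ (suc k))
⨂ {zero}  p = record
  { family    = λ A → (λ x → A Vec.[ x ]) ∈ᵘ p₀
  ; whole     = P.whole
  ; proper    = P.proper
  ; upward    = λ A⊆B → P.upward A⊆B
  ; intersect = P.intersect
  ; ultra     = λ A → P.ultra _
  }
  where
  p₀ = p Fin.zero
  module P = Ultrafilter p₀
⨂ {suc k} p = combine _∷ʳ_ (⨂ (p ∘ inject₁)) (p (fromℕ (suc k)))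

module Submission where

-- Classical logic follows from the axiom of choice, so a subset of X may be taken to be a map
-- X → Bool and an ultrafilter on X a map (X → Bool) → Bool. Ultrafilters then form a small
-- type, on which Zorn's lemma and the excluded middle are available, and
-- (p · q) A = p (λ x → q (λ y → A (x ∙ y))).
--
-- From (1) to (2): the sums Σᵢ (α(Gᵢ) + Σ_{t ∈ H(Gᵢ)} fᵢ(t)) over chains F ⊊ G₁ ⊊ ⋯ ⊊ Gₙ, for
-- varying F, generate a filter whose extensions form a closed semigroup Q. As chains can be
-- concatenated, A belongs to the tensor powers of every p ∈ Q. Let p be an idempotent of a
-- minimal left ideal L of Q. To see that the members of p are J-sets, fix F₀ and consider the
-- semigroup of formal sums a + Σ_{t ∈ β} (·)(t) arising from chains in which at some steps fᵢ
-- stays undetermined. Evaluation at f ∈ F₀ is a homomorphism to ℕ. Some idempotent ultrafilter r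
-- on formal sums with β ≠ ∅ is mapped into L by every f ∈ F₀. Idempotents of L are right
-- identities of L, so p · r, with p placed on the constant sums, is mapped to p by every f ∈ F₀
-- simultaneously.
--
-- From (2) to (1): α(F) and H(F) are chosen by recursion on |F|. A finite list records the
-- partial tuples of block sums reachable along chains below F, all of which can be continued
-- for p-many y; as p is idempotent, p-many y preserve this, and members of p are J-sets.

open import Defs
open import Algebra.Properties.CommutativeSemigroup as CommutativeSemigroup using ()
open import Data.Bool.Base using (Bool; true; false; T; not; _∧_)
open import Data.Bool.Properties using (T-∧)
open import Data.Empty using (⊥-elim)
open import Data.Fin.Base as Fin using (Fin; zero; suc)
open import Data.Fin.Properties using (injective⇒≤)
open import Data.Irrelevant using ([_])
open import Data.List.Base as List using (List; []; _∷_; _++_; filter; deduplicate; concatMap)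
open import Data.List.Membership.Propositional using (find; lose) renaming (_∈_ to _∈ₗ_)
open import Data.List.Membership.Propositional.Properties
  using (∈-map⁺; ∈-map⁻; ∈-++⁺ˡ; ∈-++⁺ʳ; ∈-++⁻; ∈-concatMap⁺; ∈-concatMap⁻; ∈-lookup)
import Data.List.Membership.Setoid as Membership
import Data.List.Membership.Setoid.Properties as Mem
open import Data.List.NonEmpty.Base as List⁺ using (List⁺; _∷_; toList; _⁺++⁺_; foldr₁)
open import Data.List.Properties using (map-∘; map-cong; map-++; map-cong-local; ++-assoc)
open import Data.List.Relation.Binary.Permutation.Propositional using (_↭_; ↭-sym; ↭⇒↭ₛ)
import Data.List.Relation.Binary.Permutation.Propositional.Properties as Perm
import Data.List.Relation.Binary.Permutation.Setoid.Properties as Permₛ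
open import Data.List.Relation.Unary.All as All using (All; []; _∷_)
open import Data.List.Relation.Unary.All.Properties using (¬Any⇒All¬)
open import Data.List.Relation.Unary.AllPairs as AllPairs using (AllPairs; []; _∷_)
open import Data.List.Relation.Unary.Any as Any using (here; there)
open import Data.List.Relation.Unary.Sorted.TotalOrder using () renaming (Sorted to IsSorted)
import Data.List.Relation.Unary.Sorted.TotalOrder.Properties as Sorted
open import Data.List.Relation.Unary.Unique.DecSetoid.Properties using (deduplicate-!)
open import Data.List.Relation.Unary.Unique.Propositional using (Unique)
import Data.List.Relation.Unary.Unique.Propositional.Properties as Unique
open import Data.List.Relation.Unary.Unique.Setoid using () renaming (Unique to Uniqueₛ)
import Data.List.Relation.Unary.Unique.Setoid.Properties as Uniqueₛ
import Data.List.Sort as Sort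
open import Data.Nat.Base as ℕ using (ℕ; zero; suc; NonZero; _<_; _≤_; _⊔_; _⊓_)
open import Data.Nat.ListAction using (sum)
open import Data.Nat.ListAction.Properties using (sum-++; sum-↭)
import Data.Nat.Properties as ℕ
open import Data.Product.Base using (Σ; ∃-syntax; _×_; _,_; proj₁; proj₂)
open import Data.Refinement.Base using (_,_; value)
open import Data.Sum.Base as Sum using (_⊎_; inj₁; inj₂; [_,_]′)
open import Data.Unit.Base using (⊤; tt)
open import Data.Vec.Base using (Vec; []; _∷_; _∷ʳ_; tabulate; lookup)
open import Data.Vec.Properties using (tabulate-cong; tabulate∘lookup)
open import Function.Base using (_∘_; id)
open import Function.Bundles using (Equivalence; Func; _⟨$⟩_; _⇔_; mk⇔)
open import Level using (0ℓ)
open import Relation.Binary.Bundles using (Setoid; DecSetoid; DecTotalOrder)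
import Relation.Binary.Construct.On as On
open import Relation.Binary.PropositionalEquality
  using (_≡_; _≢_; _≗_; refl; sym; trans; cong; cong₂; subst; _→-setoid_; module ≡-Reasoning)
open import Relation.Nullary.Decidable.Core using (Dec; yes; no; does; ¬?)
open import Relation.Nullary.Negation.Core using (¬_)
open import Relation.Unary using (Pred; _∈_)

module WithChoice (ac : AxiomOfChoice) where

  -- Classical logic

  module _ (P : Set) where

    private
      -- true and false are identified exactly when P holds.
      Glue : Setoid 0ℓ 0ℓ
      Glue = record
        { Carrier       = Bool
        ; _≈_           = λ a b → a ≡ b ⊎ P
        ; isEquivalence = record
          { refl  = inj₁ refl
          ; sym   = λ { (inj₁ e) → inj₁ (sym e) ; (inj₂ p) → inj₂ p }
          ; trans = λ { (inj₁ refl) s → s ; (inj₂ p) _ → inj₂ p }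
          }
        }
      open Setoid Glue using (_≈_) renaming (refl to ≈-refl; sym to ≈-sym; trans to ≈-trans)

    opaque
      -- Diaconescu's argument: if neither representative is reached through `P`, then `f true` and
      -- `f false` differ, while a proof of `P` would make them equal.
      lem : Dec P
      lem with ac Glue Bool _≈_ (λ x≈y x≈z → ≈-trans (≈-sym x≈y) x≈z) (λ x → x , ≈-refl)
      ... | f , f-cong , f-rep with f true in t | f false in u | f-rep true | f-rep false
      ...   | _     | _     | inj₂ p    | _         = yes p
      ...   | _     | _     | _         | inj₂ p    = yes p
      ...   | true  | false | _         | _         = no λ p → true≢false (trans (sym t) (trans (f-cong (inj₂ p)) u))
        where
        true≢false : ¬ true ≡ false
        true≢false ()

  module _ (S : Setoid 0ℓ 0ℓ) where
    private
      module S = Setoid S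
      choice = ac S S.Carrier S._≈_ (λ x≈y x≈z → S.trans (S.sym x≈y) x≈z) (λ x → x , S.refl)

    opaque
      -- One representative per class: composed with it, a construction respects the equality of `S`
      -- up to `≡`.
      canon : S.Carrier → S.Carrier
      canon = proj₁ choice

      canon-cong : ∀ {x y} → x S.≈ y → canon x ≡ canon y
      canon-cong = proj₁ (proj₂ choice)

      canon-≈ : ∀ x → x S.≈ canon x
      canon-≈ = proj₂ (proj₂ choice)

  opaque
    ⌊_⌋ : Set → Bool
    ⌊ P ⌋ = does (lem P)

    into : ∀ {P} → P → T ⌊ P ⌋
    into {P} p with lem P
    ... | yes _ = tt
    ... | no ¬p = ⊥-elim (¬p p)

    out : ∀ {P} → T ⌊ P ⌋ → P
    out {P} t with lem P
    ... | yes p = p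

  T-ext : ∀ {a b} → (T a → T b) → (T b → T a) → a ≡ b
  T-ext {true}  {true}  _ _ = refl
  T-ext {true}  {false} f _ = ⊥-elim (f tt)
  T-ext {false} {true}  _ g = ⊥-elim (g tt)
  T-ext {false} {false} _ _ = refl

  T-resp : ∀ {a b} → a ≡ b → T a → T b
  T-resp = subst T

  ∧-intro : ∀ {a b} → T a → T b → T (a ∧ b)
  ∧-intro a b = Equivalence.from T-∧ (a , b)

  ∧-elim : ∀ a b → T (a ∧ b) → T a × T b
  ∧-elim a b = Equivalence.to (T-∧ {a} {b})

  not-elim : ∀ {b} → T (not b) → ¬ T b
  not-elim {false} _ ()

  not-intro : ∀ {b} → ¬ T b → T (not b)
  not-intro {true}  ¬t = ⊥-elim (¬t tt)
  not-intro {false} _  = tt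

  by-contradiction : ∀ {P} → ¬ ¬ P → P
  by-contradiction {P} ¬¬p with lem P
  ... | yes p = p
  ... | no ¬p = ⊥-elim (¬¬p ¬p)

  -- Zorn's lemma for systems of subsets

  infix 4 _⊑_

  _⊑_ : {Y : Set} → (Y → Bool) → (Y → Bool) → Set
  F ⊑ G = ∀ y → T (F y) → T (G y)

  ⋃ : {Y : Set} → ((Y → Bool) → Bool) → Y → Bool
  ⋃ C y = ⌊ ∃[ c ] T (C c) × T (c y) ⌋

  record Chain {Y : Set} (Φ : (Y → Bool) → Set) (C : (Y → Bool) → Bool) : Set where
    field
      inhabited : ∃[ c ] T (C c)
      members   : ∀ {c} → T (C c) → Φ c
      total     : ∀ {c d} → T (C c) → T (C d) → c ⊑ d ⊎ d ⊑ c

  module Zorn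
    {Y : Set} (Φ : (Y → Bool) → Set)
    (Φ-resp : ∀ {F G} → F ≗ G → Φ F → Φ G)
    (Φ-⋃ : ∀ {C} → Chain Φ C → Φ (⋃ C))
    {base : Y → Bool} (Φ-base : Φ base)
    where

    private
      Extension : (Y → Bool) → Set
      Extension F = ∃[ G ] F ⊑ G × Φ G × ¬ G ⊑ F

      extend : (Y → Bool) → Y → Bool
      extend F with lem (Extension F)
      ... | yes (G , _) = G
      ... | no _        = F

      extend-⊒ : ∀ F → F ⊑ extend F
      extend-⊒ F with lem (Extension F)
      ... | yes (_ , F⊑G , _) = F⊑G
      ... | no _              = λ _ → id

      extend-Φ : ∀ F → Φ F → Φ (extend F)
      extend-Φ F ΦF with lem (Extension F)
      ... | yes (_ , _ , ΦG , _) = ΦG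
      ... | no _                 = ΦF

      extend-strict : ∀ F → extend F ⊑ F → ¬ Extension F
      extend-strict F ⊑F with lem (Extension F)
      ... | yes (_ , _ , _ , ⋢F) = λ _ → ⋢F ⊑F
      ... | no ¬ext              = ¬ext

      rep : (Y → Bool) → Y → Bool
      rep = canon (Y →-setoid Bool)

      rep-≗ : ∀ F → F ≗ rep F
      rep-≗ = canon-≈ (Y →-setoid Bool)

      -- The witness that `extend` takes from `lem` may depend on the presentation of F, so the
      -- representative is taken first; `next-cong` relies on this.
      next : (Y → Bool) → Y → Bool
      next F = extend (rep F)

      next-⊒ : ∀ F → F ⊑ next F
      next-⊒ F y = extend-⊒ (rep F) y ∘ T-resp (rep-≗ F y)

      next-cong : ∀ {F G} → F ⊑ G → G ⊑ F → next F ⊑ next G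
      next-cong F⊑G G⊑F y = T-resp (cong (λ H → extend H y)
        (canon-cong (Y →-setoid Bool) λ y → T-ext (F⊑G y) (G⊑F y)))

      -- The tower of Bourbaki and Witt, a transfinite iteration of `next` without ordinals.
      data Tower : (Y → Bool) → Set where
        start : Tower base
        step  : ∀ {F} → Tower F → Tower (next F)
        sup   : ∀ {C} → ∃[ c ] T (C c) → (∀ {c} → T (C c) → Tower c) → Tower (⋃ C)

      ⋃-⊑ : {C : (Y → Bool) → Bool} {G : Y → Bool} → (∀ {c} → T (C c) → c ⊑ G) → ⋃ C ⊑ G
      ⋃-⊑ bound y t with out t
      ... | _ , Cc , cy = bound Cc y cy

      ⊑-⋃ : {C : (Y → Bool) → Bool} {c : Y → Bool} → T (C c) → c ⊑ ⋃ C
      ⊑-⋃ Cc _ cy = into (_ , Cc , cy)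

      base-⊑ : ∀ {F} → Tower F → base ⊑ F
      base-⊑ start                 _ t = t
      base-⊑ (step {F} F∈)         y t = next-⊒ F y (base-⊑ F∈ y t)
      base-⊑ (sup (_ , Cc) C⊆)     y t = ⊑-⋃ Cc y (base-⊑ (C⊆ Cc) y t)

      bounded? : (C : (Y → Bool) → Bool) (G : Y → Bool) → (∀ {c} → T (C c) → c ⊑ G) ⊎ (∃[ c ] T (C c) × ¬ c ⊑ G)
      bounded? C G with lem (∃[ c ] T (C c) × ¬ c ⊑ G)
      ... | yes e = inj₂ e
      ... | no ¬e = inj₁ λ {c} Cc → by-contradiction λ c⋢G → ¬e (c , Cc , c⋢G)

      Comparable : (Y → Bool) → Set
      Comparable F = ∀ {G} → Tower G → F ⊑ G ⊎ next G ⊑ F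

      -- Induction on G. At a successor, comparability of F with the preceding stage decides; at a
      -- union, either all members lie below F or one lies above `next F`.
      gap : ∀ {F} → Comparable F → Tower F → ∀ {G} → Tower G → next F ⊑ G ⊎ G ⊑ F
      gap cmp F∈ start = inj₂ (base-⊑ F∈)
      gap {F} cmp F∈ (step {G} G∈) with gap cmp F∈ G∈ | cmp G∈
      ... | inj₁ F⁺⊑G | _          = inj₁ λ y → next-⊒ G y ∘ F⁺⊑G y
      ... | inj₂ _    | inj₂ G⁺⊑F  = inj₂ G⁺⊑F
      ... | inj₂ G⊑F  | inj₁ F⊑G   = inj₁ (next-cong F⊑G G⊑F)
      gap {F} cmp F∈ (sup {C} _ C⊆) with bounded? C F
      ... | inj₁ C⊑F = inj₂ (⋃-⊑ C⊑F)
      ... | inj₂ (c , Cc , c⋢F) with gap cmp F∈ (C⊆ Cc)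
      ...   | inj₁ F⁺⊑c = inj₁ λ y → ⊑-⋃ {c = c} Cc y ∘ F⁺⊑c y
      ...   | inj₂ c⊑F  = ⊥-elim (c⋢F c⊑F)

      comparable : ∀ {F} → Tower F → Comparable F
      comparable start G∈ = inj₁ (base-⊑ G∈)
      comparable (step {F} F∈) G∈ with gap (comparable F∈) F∈ G∈
      ... | inj₁ F⁺⊑G = inj₁ F⁺⊑G
      ... | inj₂ G⊑F with comparable F∈ G∈
      ...   | inj₁ F⊑G  = inj₂ (next-cong G⊑F F⊑G)
      ...   | inj₂ G⁺⊑F = inj₂ λ y → next-⊒ F y ∘ G⁺⊑F y
      comparable (sup {C} _ C⊆) {G} G∈ with bounded? C G
      ... | inj₁ C⊑G = inj₁ (⋃-⊑ C⊑G)
      ... | inj₂ (c , Cc , c⋢G) with comparable (C⊆ Cc) G∈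
      ...   | inj₁ c⊑G  = ⊥-elim (c⋢G c⊑G)
      ...   | inj₂ G⁺⊑c = inj₂ λ y → ⊑-⋃ {c = c} Cc y ∘ G⁺⊑c y

      Tower-total : ∀ {F G} → Tower F → Tower G → F ⊑ G ⊎ G ⊑ F
      Tower-total {G = G} F∈ G∈ with comparable F∈ G∈
      ... | inj₁ F⊑G  = inj₁ F⊑G
      ... | inj₂ G⁺⊑F = inj₂ λ y → G⁺⊑F y ∘ next-⊒ G y

      Tower-Φ : ∀ {F} → Tower F → Φ F
      Tower-Φ start           = Φ-base
      Tower-Φ (step {F} F∈)   = extend-Φ (rep F) (Φ-resp (rep-≗ F) (Tower-Φ F∈))
      Tower-Φ (sup ne C⊆) = Φ-⋃ record
        { inhabited = ne
        ; members   = λ Cc → Tower-Φ (C⊆ Cc)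
        ; total     = λ Cc Cd → Tower-total (C⊆ Cc) (C⊆ Cd)
        }

      top : Y → Bool
      top = ⋃ λ F → ⌊ Tower F ⌋

      top∈ : Tower top
      top∈ = sup (base , into start) out

    opaque
      -- The tower contains `next top`, which therefore lies below `top`; as `extend` enlarges
      -- whenever it can, `top` has no proper extension satisfying `Φ`.
      maximal : ∃[ M ] base ⊑ M × Φ M × (∀ G → M ⊑ G → Φ G → G ⊑ M)
      maximal = top , base-⊑ top∈ , Tower-Φ top∈ , λ G top⊑G ΦG → by-contradiction λ G⋢top →
        extend-strict (rep top)
          (λ y → T-resp (rep-≗ top y) ∘ ⊑-⋃ (into (step top∈)) y)
          (G , (λ y → top⊑G y ∘ T-resp (sym (rep-≗ top y))) , ΦG , λ G⊑ → G⋢top λ y → T-resp (sym (rep-≗ top y)) ∘ G⊑ y)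

  -- Filters and ultrafilters

  Subset : Set → Set
  Subset X = X → Bool

  Family : Set → Set
  Family X = Subset X → Bool

  record IsFilter {X : Set} (F : Family X) : Set where
    field
      whole     : T (F λ _ → true)
      inhabited : ∀ {A} → T (F A) → ∃[ x ] T (A x)
      up        : ∀ {A B} → (∀ x → T (A x) → T (B x)) → T (F A) → T (F B)
      meet      : ∀ {A B C} → (∀ x → T (A x) → T (B x) → T (C x)) → T (F A) → T (F B) → T (F C)

  IsFilter-resp : ∀ {X} {F G : Family X} → F ≗ G → IsFilter F → IsFilter G
  IsFilter-resp {F = F} {G} F≗G f = record
    { whole     = to whole
    ; inhabited = inhabited ∘ from
    ; up        = λ A⊆B → to ∘ up A⊆B ∘ from
    ; meet      = λ A∩B⊆C a b → to (meet A∩B⊆C (from a) (from b))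
    }
    where
    open IsFilter f
    to : ∀ {A} → T (F A) → T (G A)
    to = T-resp (F≗G _)
    from : ∀ {A} → T (G A) → T (F A)
    from = T-resp (sym (F≗G _))

  IsFilter-⋃ : ∀ {X} {C : Family X → Bool} → Chain IsFilter C → IsFilter (⋃ C)
  IsFilter-⋃ {X} {C} chain = record
    { whole     = let c , Cc = Chain.inhabited chain in
                  into (c , Cc , IsFilter.whole (members Cc))
    ; inhabited = λ t → let _ , Cc , cA = out t in IsFilter.inhabited (members Cc) cA
    ; up        = λ A⊆B t → let c , Cc , cA = out t in into (c , Cc , IsFilter.up (members Cc) A⊆B cA)
    ; meet      = λ A∩B⊆C a b → meet A∩B⊆C (out a) (out b)
    }
    where
    open Chain chain using (members; total)
    meet : ∀ {A B D : Subset X} → (∀ x → T (A x) → T (B x) → T (D x)) →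
           ∃[ c ] T (C c) × T (c A) → ∃[ c ] T (C c) × T (c B) → T (⋃ C D)
    meet A∩B⊆D (c , Cc , cA) (d , Cd , dB) with total Cc Cd
    ... | inj₁ c⊑d = into (d , Cd , IsFilter.meet (members Cd) A∩B⊆D (c⊑d _ cA) dB)
    ... | inj₂ d⊑c = into (c , Cc , IsFilter.meet (members Cc) A∩B⊆D cA (d⊑c _ dB))

  module _ {X : Set} (Ψ : Family X → Set)
    (Ψ-resp : ∀ {F G} → F ≗ G → Ψ F → Ψ G)
    (Ψ-⋃ : ∀ {C} → Chain Ψ C → Ψ (⋃ C))
    where

    private
      Φ : Family X → Set
      Φ F = IsFilter F × Ψ F

      project : ∀ {Φ′ : Family X → Set} {C} → (∀ {c} → Φ c → Φ′ c) → Chain Φ C → Chain Φ′ C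
      project f ch = record
        { inhabited = Chain.inhabited ch ; members = f ∘ Chain.members ch ; total = Chain.total ch }

    opaque
      -- Maximal filters correspond to minimal closed sets of ultrafilters. `Ψ` is trivial when a
      -- single ultrafilter is sought; later it makes the closed set a subsemigroup or a left ideal.
      maximalFilter : ∀ {F} → IsFilter F → Ψ F →
        ∃[ M ] F ⊑ M × IsFilter M × Ψ M × (∀ G → M ⊑ G → IsFilter G → Ψ G → G ⊑ M)
      maximalFilter f ψ with Zorn.maximal Φ
        (λ e (f , ψ) → IsFilter-resp e f , Ψ-resp e ψ)
        (λ ch → IsFilter-⋃ (project proj₁ ch) , Ψ-⋃ (project proj₂ ch)) (f , ψ)
      ... | M , F⊑M , (m , ψM) , max = M , F⊑M , m , ψM , λ G M⊑G g ψG → max G M⊑G (g , ψG)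

  record Ultra (X : Set) : Set where
    field
      fam      : Family X
      isFilter : IsFilter fam
      ultra    : ∀ A → T (fam A) ⊎ T (fam (not ∘ A))
    open IsFilter isFilter public

    fam-cong : ∀ {A B} → A ≗ B → fam A ≡ fam B
    fam-cong A≗B = T-ext (up λ x → T-resp (A≗B x)) (up λ x → T-resp (sym (A≗B x)))

    exclusive : ∀ {A} → T (fam A) → ¬ T (fam (not ∘ A))
    exclusive a a′ = proj₂ (inhabited {λ _ → false} (meet (λ _ y n → not-elim n y) a a′))

    complement : ∀ {A} → ¬ T (fam A) → T (fam (not ∘ A))
    complement {A} ¬a with ultra A
    ... | inj₁ a = ⊥-elim (¬a a)
    ... | inj₂ a = a

  open Ultra public using (fam; fam-cong; isFilter)

  ⊑⇒≗ : ∀ {X} (p q : Ultra X) → fam p ⊑ fam q → fam p ≗ fam q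
  ⊑⇒≗ p q p⊑q A = T-ext (p⊑q A) λ qA → by-contradiction λ ¬pA →
    Ultra.exclusive q qA (p⊑q _ (Ultra.complement p ¬pA))

  opaque
    ultrafilter-lemma : ∀ {X} {F : Family X} → IsFilter F → Σ (Ultra X) λ p → F ⊑ fam p
    ultrafilter-lemma {X} {F} f with maximalFilter (λ _ → ⊤) (λ _ _ → tt) (λ _ → tt) f tt
    ... | M , F⊑M , m , _ , max = record { fam = M ; isFilter = m ; ultra = dichotomy } , F⊑M
      where
      open IsFilter m
      module _ (A : Subset X) where
        adjoin : Family X
        adjoin B = ⌊ (∃[ D ] T (M D) × (∀ x → T (D x) → T (A x) → T (B x))) ⌋

        adjoin-filter : ¬ (∃[ D ] T (M D) × (∀ x → T (D x) → ¬ T (A x))) → IsFilter adjoin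
        adjoin-filter ¬e = record
          { whole     = into (_ , whole , λ _ _ _ → tt)
          ; inhabited = λ b → let D , MD , DA⊆B = out b in by-contradiction λ ¬x →
                          ¬e (D , MD , λ x Dx Ax → ¬x (x , DA⊆B x Dx Ax))
          ; up        = λ B⊆B′ b → let D , MD , DA⊆B = out b in
                          into (D , MD , λ x Dx Ax → B⊆B′ x (DA⊆B x Dx Ax))
          ; meet      = λ B∩B′⊆C b b′ → let D , MD , DA⊆B = out b ; E , ME , EA⊆B′ = out b′ in
                          into ((λ x → D x ∧ E x) , meet (λ _ → ∧-intro) MD ME , λ x DEx Ax →
                            let Dx , Ex = ∧-elim (D x) (E x) DEx in B∩B′⊆C x (DA⊆B x Dx Ax) (EA⊆B′ x Ex Ax))
          }

        dichotomy : T (M A) ⊎ T (M (not ∘ A))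
        dichotomy with lem (∃[ D ] T (M D) × (∀ x → T (D x) → ¬ T (A x)))
        ... | yes (D , MD , D⊆¬A) = inj₂ (up (λ x → not-intro ∘ D⊆¬A x) MD)
        ... | no ¬e = inj₁ (max adjoin (λ B MB → into (B , MB , λ _ Bx _ → Bx)) (adjoin-filter ¬e) tt A
                        (into (_ , whole , λ _ _ Ax → Ax)))

  image : ∀ {X Y : Set} → (X → Y) → Ultra X → Ultra Y
  image g p = record
    { fam      = λ A → fam p (A ∘ g)
    ; isFilter = record
      { whole     = whole
      ; inhabited = λ a → let x , t = inhabited a in g x , t
      ; up        = λ A⊆B → up (A⊆B ∘ g)
      ; meet      = λ A∩B⊆C → meet (A∩B⊆C ∘ g)
      }
    ; ultra    = λ A → ultra (A ∘ g)
    }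
    where open Ultra p

  -- The ultrafilters extending this filter form the topological closure of `D`, so
  -- `closure D ⊑ fam q → D q` says that `D` is closed.
  closure : ∀ {X} → (Ultra X → Set) → Family X
  closure D A = ⌊ (∀ r → D r → T (fam r A)) ⌋

  closure-filter : ∀ {X} {D : Ultra X → Set} → Σ (Ultra X) D → IsFilter (closure D)
  closure-filter (r , Dr) = record
    { whole     = into λ r _ → Ultra.whole r
    ; inhabited = λ a → Ultra.inhabited r (out a r Dr)
    ; up        = λ A⊆B a → into λ r Dr → Ultra.up r A⊆B (out a r Dr)
    ; meet      = λ A∩B⊆C a b → into λ r Dr → Ultra.meet r A∩B⊆C (out a r Dr) (out b r Dr)
    }

  -- The semigroup of ultrafilters

  module Semigroup {X : Set} (_∙_ : X → X → X) (assoc : ∀ x y z → (x ∙ y) ∙ z ≡ x ∙ (y ∙ z)) where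

    infixl 7 _⋆_ _·_

    _⋆_ : Family X → Family X → Family X
    (F ⋆ G) A = F λ x → G λ y → A (x ∙ y)

    ⋆-filter : ∀ {F G} → IsFilter F → IsFilter G → IsFilter (F ⋆ G)
    ⋆-filter f g = record
      { whole     = F.up (λ _ _ → G.whole) F.whole
      ; inhabited = λ a → let x , b = F.inhabited a ; y , c = G.inhabited b in x ∙ y , c
      ; up        = λ A⊆B → F.up λ x → G.up λ y → A⊆B (x ∙ y)
      ; meet      = λ A∩B⊆C → F.meet λ x → G.meet λ y → A∩B⊆C (x ∙ y)
      }
      where
      module F = IsFilter f
      module G = IsFilter g

    _·_ : Ultra X → Ultra X → Ultra X
    p · q = record
      { fam      = fam p ⋆ fam q
      ; isFilter = ⋆-filter p.isFilter q.isFilter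
      ; ultra    = dichotomy
      }
      where
      module p = Ultra p
      module q = Ultra q
      dichotomy : ∀ A → T ((fam p ⋆ fam q) A) ⊎ T ((fam p ⋆ fam q) (not ∘ A))
      dichotomy A with p.ultra (λ x → fam q λ y → A (x ∙ y))
      ... | inj₁ a = inj₁ a
      ... | inj₂ a = inj₂ (p.up (λ _ → q.complement ∘ not-elim) a)

    infix 4 _≈_
    _≈_ : Ultra X → Ultra X → Set
    p ≈ q = fam p ≗ fam q

    ·-assoc : ∀ p q r → (p · q) · r ≈ p · (q · r)
    ·-assoc p q r A = fam-cong p λ x → fam-cong q λ y → fam-cong r λ z → cong A (assoc x y z)

    ·-congˡ : ∀ {p p′} q → p ≈ p′ → p · q ≈ p′ · q
    ·-congˡ q p≈p′ A = p≈p′ _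

    ·-congʳ : ∀ p {q q′} → q ≈ q′ → p · q ≈ p · q′
    ·-congʳ p q≈q′ A = fam-cong p λ x → q≈q′ _

    -- A filter F stands for the closed set of the ultrafilters extending it. If Q is a
    -- filter too, Absorbs Q L says that r · q extends L whenever r extends Q and q extends L.
    Absorbs : Family X → Family X → Set
    Absorbs Q L = ∀ A → T (L A) → ∀ q → L ⊑ fam q → T (Q λ x → fam q λ y → A (x ∙ y))

    absorbs-· : ∀ {Q L} → Absorbs Q L → ∀ r q → Q ⊑ fam r → L ⊑ fam q → L ⊑ fam (r · q)
    absorbs-· abs r q Q⊑r L⊑q A LA = Q⊑r _ (abs A LA q L⊑q)

    absorbs-⊑ : ∀ {Q Q′ L} → Q ⊑ Q′ → Absorbs Q L → Absorbs Q′ L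
    absorbs-⊑ Q⊑Q′ abs A LA q L⊑q = Q⊑Q′ _ (abs A LA q L⊑q)

    -- Compactness: right translation by p is a closed map.
    opaque
      lift : ∀ {M} → IsFilter M → ∀ p q → M ⋆ fam p ⊑ fam q → Σ (Ultra X) λ r → M ⊑ fam r × q ≈ r · p
      lift {M} m p q Mp⊑q with ultrafilter-lemma pullback-filter
        where
        open IsFilter m
        module q = Ultra q
        module p = Ultra p
        -- Generated by M and the sets that r must contain for r · p to extend q. Were one of its
        -- members empty, the complement of a member of q would lie in `M ⋆ fam p`, hence in q.
        pullback : Family X
        pullback D = ⌊ (∃[ A ] ∃[ B ] T (M A) × T (fam q B) ×
          (∀ x → T (A x) → T (fam p λ y → B (x ∙ y)) → T (D x))) ⌋

        pullback-filter : IsFilter pullback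
        pullback-filter = record
          { whole     = into (_ , _ , whole , q.whole , λ _ _ _ → tt)
          ; inhabited = λ d → let A , B , MA , qB , h = out d in by-contradiction λ ¬x →
                          q.exclusive qB (Mp⊑q _ (up (λ x Ax → p.complement λ b → ¬x (x , h x Ax b)) MA))
          ; up        = λ D⊆D′ d → let A , B , MA , qB , h = out d in
                          into (A , B , MA , qB , λ x a b → D⊆D′ x (h x a b))
          ; meet      = λ D∩D′⊆E d d′ → let A , B , MA , qB , h = out d ; A′ , B′ , MA′ , qB′ , h′ = out d′ in
                          into ( (λ x → A x ∧ A′ x) , (λ y → B y ∧ B′ y)
                               , meet (λ _ → ∧-intro) MA MA′ , q.meet (λ _ → ∧-intro) qB qB′
                               , λ x a b → let Ax , A′x = ∧-elim (A x) (A′ x) a in D∩D′⊆E x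
                                   (h x Ax (p.up (λ y → proj₁ ∘ ∧-elim (B (x ∙ y)) (B′ (x ∙ y))) b))
                                   (h′ x A′x (p.up (λ y → proj₂ ∘ ∧-elim (B (x ∙ y)) (B′ (x ∙ y))) b)))
          }
      ... | r , pb⊑r = r
          , (λ A MA → pb⊑r A (into (A , _ , MA , Ultra.whole q , λ _ a _ → a)))
          , ⊑⇒≗ q (r · p) (λ B qB → pb⊑r _ (into (_ , B , IsFilter.whole m , qB , λ _ _ b → b)))

    -- By `lift`, q is r · p for some r extending M. For s extending M, s · (r · p) = (s · r) · p,
    -- and s · r extends M because M absorbs itself.
    absorbs-⋆ : ∀ {M} → IsFilter M → Absorbs M M → ∀ p → Absorbs M (M ⋆ fam p)
    absorbs-⋆ {M} m abs p A MpA q Mp⊑q with lift m p q Mp⊑q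
    ... | r , M⊑r , q≈rp = IsFilter.up m
      (λ x → T-resp (trans (fam-cong r λ z → fam-cong p λ y → cong A (assoc x z y)) (sym (q≈rp _))))
      (abs _ MpA r M⊑r)

    closure-absorbs : ∀ {D : Ultra X → Set} → (∀ q → closure D ⊑ fam q → D q) →
      (∀ r q → D r → D q → D (r · q)) → Absorbs (closure D) (closure D)
    closure-absorbs closed mult A a q D⊑q = into λ r Dr → out a (r · q) (mult r q Dr (closed q D⊑q))

    opaque
      -- M stands for a minimal closed subsemigroup, and p is a point of it. The products r · p form
      -- another one inside it, so r · p = p for some r; all such r form yet another, so p is one of
      -- them.
      ellis-numakura : ∀ {C} → IsFilter C → Absorbs C C → Σ (Ultra X) λ p → C ⊑ fam p × p · p ≈ p
      ellis-numakura {C} c C-abs with maximalFilter (λ F → Absorbs F F)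
        (λ {F} {G} F≗G abs A GA q G⊑q → T-resp (F≗G _)
           (abs A (T-resp (sym (F≗G A)) GA) q λ B → G⊑q B ∘ T-resp (F≗G B)))
        (λ {D} ch A t q D⊑q → let F , DF , FA = out {P = ∃[ F ] T (D F) × T (F A)} t in
           into (F , DF , Chain.members ch DF A FA q λ B FB → D⊑q B (into (F , DF , FB))))
        c C-abs
      ... | M , C⊑M , m , M-abs , max with ultrafilter-lemma m
      ...   | p , M⊑p = p , (λ A → M⊑p A ∘ C⊑M A) , λ A → sym (p≈pp A)
        where
        M⊑Mp : M ⊑ M ⋆ fam p
        M⊑Mp A MA = M-abs A MA p M⊑p

        Mp⊑M : M ⋆ fam p ⊑ M
        Mp⊑M = max _ M⊑Mp (⋆-filter m (isFilter p)) (absorbs-⊑ M⊑Mp (absorbs-⋆ m M-abs p))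

        Fixes : Ultra X → Set
        Fixes r = M ⊑ fam r × r · p ≈ p

        fixing : Σ (Ultra X) Fixes
        fixing with lift m p p (λ A → M⊑p A ∘ Mp⊑M A)
        ... | r , M⊑r , p≈rp = r , M⊑r , λ A → sym (p≈rp A)

        p-stable : ∀ {B} → T (fam p B) → T (closure Fixes λ x → fam p λ y → B (x ∙ y))
        p-stable {B} pB = into λ r (_ , rp≈p) → T-resp (sym (rp≈p B)) pB

        Fixes-closed : ∀ q → closure Fixes ⊑ fam q → Fixes q
        Fixes-closed q Fix⊑q = (λ A MA → Fix⊑q A (into λ r (M⊑r , _) → M⊑r A MA))
          , λ B → sym (⊑⇒≗ p (q · p) (λ D pD → Fix⊑q _ (p-stable pD)) B)

        Fixes-· : ∀ r q → Fixes r → Fixes q → Fixes (r · q)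
        Fixes-· r q (M⊑r , rp≈p) (M⊑q , qp≈p) = absorbs-· M-abs r q M⊑r M⊑q
          , λ B → trans (·-assoc r q p B) (trans (·-congʳ r {q · p} {p} qp≈p B) (rp≈p B))

        p≈pp : p ≈ p · p
        p≈pp = ⊑⇒≗ p (p · p) λ B pB → M⊑p _ (max (closure Fixes)
          (λ A MA → into λ r (M⊑r , _) → M⊑r A MA) (closure-filter fixing)
          (closure-absorbs {Fixes} Fixes-closed Fixes-·) _ (p-stable pB))

    opaque
      idempotent-in : (D : Ultra X → Set) → Σ (Ultra X) D → (∀ q → closure D ⊑ fam q → D q) →
        (∀ r q → D r → D q → D (r · q)) → Σ (Ultra X) λ p → D p × p · p ≈ p
      idempotent-in D inh closed mult = go (ellis-numakura (closure-filter inh) (closure-absorbs {D} closed mult))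
        where
        go : (Σ (Ultra X) λ p → closure D ⊑ fam p × p · p ≈ p) → Σ (Ultra X) λ p → D p × p · p ≈ p
        go (p , D⊑p , pp≈p) = p , closed p D⊑p , pp≈p

    -- The ultrafilters extending `ideal` form a minimal left ideal of those extending Q.
    record MinimalIdempotent (Q : Family X) : Set where
      field
        ideal         : Family X
        Q⊑ideal       : Q ⊑ ideal
        ideal-absorbs : Absorbs Q ideal
        point         : Ultra X
        ideal⊑point   : ideal ⊑ fam point
        point-idem    : point · point ≈ point
        right-unit    : ∀ r → ideal ⊑ fam r → r · r ≈ r → point · r ≈ point

    opaque
      minimalIdempotent : ∀ {Q} → IsFilter Q → Absorbs Q Q → MinimalIdempotent Q
      minimalIdempotent {Q} Q-filter Q-abs with maximalFilter (Absorbs Q)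
        (λ {F} {G} F≗G abs A GA q G⊑q → abs A (T-resp (sym (F≗G A)) GA) q λ B → G⊑q B ∘ T-resp (F≗G B))
        (λ {D} ch A t q D⊑q → let F , DF , FA = out {P = ∃[ F ] T (D F) × T (F A)} t in
           Chain.members ch DF A FA q λ B FB → D⊑q B (into (F , DF , FB)))
        Q-filter Q-abs
      ... | L , Q⊑L , L-filter , L-abs , max with ellis-numakura L-filter (absorbs-⊑ Q⊑L L-abs)
      ...   | p , L⊑p , pp≈p = record
        { ideal = L ; Q⊑ideal = Q⊑L ; ideal-absorbs = L-abs
        ; point = p ; ideal⊑point = L⊑p ; point-idem = pp≈p ; right-unit = right-unit }
        where
        -- The products s · r with s extending Q form a left ideal inside that of L, so minimality
        -- yields p = s · r, whence p · r = s · r · r = p.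
        right-unit : ∀ r → L ⊑ fam r → r · r ≈ r → p · r ≈ p
        right-unit r L⊑r rr≈r with lift Q-filter r p
          (λ A → L⊑p A ∘ max (Q ⋆ fam r) (λ B LB → L-abs B LB r L⊑r) (⋆-filter Q-filter (isFilter r))
                           (absorbs-⋆ Q-filter Q-abs r) A)
        ... | s , _ , p≈sr = λ A → trans (·-congˡ {p} {s · r} r p≈sr A)
                (trans (·-assoc s r r A) (trans (·-congʳ s {r · r} {r} rr≈r A) (sym (p≈sr A))))

  -- Finite sets

  module FiniteSets (S : Setoid 0ℓ 0ℓ) where
    open Setoid S using (Carrier; _≈_; isEquivalence)
    private
      _≟_ = λ x y → lem (x ≈ y)

      decSetoid : DecSetoid 0ℓ 0ℓ
      decSetoid = record { isDecEquivalence = record { isEquivalence = isEquivalence ; _≟_ = _≟_ } }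

    fromList⁺ : List⁺ Carrier → 𝒫f S
    fromList⁺ (x ∷ xs) = finset (x ∷ filter (¬? ∘ (x ≟_)) (deduplicate _≟_ xs)) (deduplicate-! decSetoid (x ∷ xs))

    ∈-fromList⁺⁺ : ∀ {z} xs → Membership._∈_ S z (toList xs) → z ∈f fromList⁺ xs
    ∈-fromList⁺⁺ xs = Mem.∈-deduplicate⁺ S _≟_ (λ y≈z x≈z → Setoid.trans S x≈z (Setoid.sym S y≈z))

    infixr 6 _∪f_
    _∪f_ : 𝒫f S → 𝒫f S → 𝒫f S
    F ∪f G = fromList⁺ (elements F ⁺++⁺ elements G)

    ∪f-⊆ˡ : ∀ F G → F ⊆f (F ∪f G)
    ∪f-⊆ˡ F@record{} G@record{} x∈F = ∈-fromList⁺⁺ (elements F ⁺++⁺ elements G) (Mem.∈-++⁺ˡ S x∈F)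

    ∪f-⊆ʳ : ∀ F G → G ⊆f (F ∪f G)
    ∪f-⊆ʳ F G x∈G = ∈-fromList⁺⁺ (elements F ⁺++⁺ elements G) (Mem.∈-++⁺ʳ S (toList (elements F)) x∈G)

    singleton : Carrier → 𝒫f S
    singleton x = fromList⁺ (x ∷ [])

    ∈-singleton : ∀ x → x ∈f singleton x
    ∈-singleton x = here (Setoid.refl S)

    head∈ : ∀ F → _∈f_ {S} (List⁺.head (elements F)) F
    head∈ F = here (Setoid.refl S)

  ⊊f-trans : ∀ {S : Setoid 0ℓ 0ℓ} {E F G : 𝒫f S} → E ⊆f F → F ⊊f G → E ⊊f G
  ⊊f-trans E⊆F (F⊆G , G⊈F) = F⊆G ∘ E⊆F , λ G⊆E → G⊈F (λ {x} → E⊆F {x} ∘ G⊆E {x})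

  -- Sums of positive integers

  ℕ⁺-≡ : ∀ {x y : ℕ⁺} → value x ≡ value y → x ≡ y
  ℕ⁺-≡ refl = refl

  +⁺-assoc : ∀ x y z → (x +⁺ y) +⁺ z ≡ x +⁺ (y +⁺ z)
  +⁺-assoc x y z = ℕ⁺-≡ (ℕ.+-assoc (value x) (value y) (value z))

  suc⁺ : ℕ⁺ → ℕ⁺
  suc⁺ (n , _) = suc n , [ _ ]

  +1⁺ : ∀ i → i +⁺ 1⁺ ≡ suc⁺ i
  +1⁺ i = ℕ⁺-≡ (ℕ.+-comm (value i) 1)

  value>0 : ∀ (x : ℕ⁺) → 0 < value x
  value>0 (suc _ , _)      = ℕ.z<s
  value>0 (zero , [ n≢0 ]) = ⊥-elim-irr n≢0
    where
    ⊥-elim-irr : .(NonZero 0) → 0 < 0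
    ⊥-elim-irr ()

  total : (ℕ⁺ → ℕ⁺) → List ℕ⁺ → ℕ
  total f ts = sum (List.map (value ∘ f) ts)

  value-∑ : ∀ β f → value (∑ β f) ≡ total f (toList (elements β))
  value-∑ (finset (x ∷ xs) _) f = go x xs
    where
    go : ∀ x xs → value (foldr₁ _+⁺_ (List⁺.map f (x ∷ xs))) ≡ total f (x ∷ xs)
    go x []       = sym (ℕ.+-identityʳ _)
    go x (y ∷ ys) = cong (value (f x) ℕ.+_) (go y ys)

  ∑-cong : ∀ β {f g} → f ≗ g → ∑ β f ≡ ∑ β g
  ∑-cong β {f} {g} f≗g = ℕ⁺-≡ (trans (value-∑ β f)
    (trans (cong sum (map-cong (cong value ∘ f≗g) (toList (elements β)))) (sym (value-∑ β g))))

  -- Maxima and minima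

  ≤-max : ∀ β {x} → x ∈f β → value x ≤ max β
  ≤-max (finset (y ∷ ys) _) = go y ys
    where
    go : ∀ y ys {x} → Membership._∈_ ℕ⁺-setoid x (y ∷ ys) → value x ≤ foldr₁ _⊔_ (List⁺.map value (y ∷ ys))
    go y []       (here refl) = ℕ.≤-refl
    go y (z ∷ zs) (here refl) = ℕ.m≤m⊔n _ _
    go y (z ∷ zs) (there x∈)  = ℕ.≤-trans (go z zs x∈) (ℕ.m≤n⊔m _ _)

  min-≤ : ∀ β {x} → x ∈f β → min β ≤ value x
  min-≤ (finset (y ∷ ys) _) = go y ys
    where
    go : ∀ y ys {x} → Membership._∈_ ℕ⁺-setoid x (y ∷ ys) → foldr₁ _⊓_ (List⁺.map value (y ∷ ys)) ≤ value x
    go y []       (here refl) = ℕ.≤-refl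
    go y (z ∷ zs) (here refl) = ℕ.m⊓n≤m _ _
    go y (z ∷ zs) (there x∈)  = ℕ.≤-trans (ℕ.m⊓n≤n _ _) (go z zs x∈)

  max-< : ∀ β {n} → (∀ {x} → x ∈f β → value x < n) → max β < n
  max-< (finset (y ∷ ys) _) = go y ys
    where
    go : ∀ y ys {n} → (∀ {x} → Membership._∈_ ℕ⁺-setoid x (y ∷ ys) → value x < n) →
         foldr₁ _⊔_ (List⁺.map value (y ∷ ys)) < n
    go y []       h = h (here refl)
    go y (z ∷ zs) h = ℕ.⊔-pres-<m (h (here refl)) (go z zs (h ∘ there))

  <-min : ∀ β {n} → (∀ {x} → x ∈f β → n < value x) → n < min β
  <-min (finset (y ∷ ys) _) = go y ys
    where
    go : ∀ y ys {n} → (∀ {x} → Membership._∈_ ℕ⁺-setoid x (y ∷ ys) → n < value x) →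
         n < foldr₁ _⊓_ (List⁺.map value (y ∷ ys))
    go y []       h = h (here refl)
    go y (z ∷ zs) h = ℕ.⊓-pres-m< (h (here refl)) (go z zs (h ∘ there))

  min≤max : ∀ β → min β ≤ max β
  min≤max β = ℕ.≤-trans (min-≤ β (head∈ β)) (≤-max β (head∈ β))
    where open FiniteSets ℕ⁺-setoid

  <f-intro : ∀ {β γ} → (∀ {x y} → x ∈f β → y ∈f γ → value x < value y) → β <f γ
  <f-intro {β} {γ} h = max-< β λ x∈ → <-min γ λ y∈ → h x∈ y∈

  <f-elim : ∀ {β γ} → β <f γ → ∀ {x y} → x ∈f β → y ∈f γ → value x < value y
  <f-elim {β} {γ} β<γ x∈ y∈ = ℕ.≤-<-trans (≤-max β x∈) (ℕ.<-≤-trans β<γ (min-≤ γ y∈))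

  module Functions = FiniteSets ℕ⁺^ℕ⁺
  module Naturals = FiniteSets ℕ⁺-setoid

  -- Its constant value exceeds f(1) for every f in F, so proper supersets always exist and no chain
  -- gets stuck.
  fresh : 𝒫f ℕ⁺^ℕ⁺ → ℕ⁺ → ℕ⁺
  fresh F _ = suc (List.foldr (λ f n → value (f 1⁺) ⊔ n) 0 (toList (elements F))) , [ _ ]

  fresh∉ : ∀ F → ¬ fresh F ∈f F
  fresh∉ F g∈F = ℕ.<-irrefl refl (bound _ g∈F)
    where
    bound : ∀ xs {g} → Membership._∈_ ℕ⁺^ℕ⁺ g xs → value (g 1⁺) < suc (List.foldr (λ f n → value (f 1⁺) ⊔ n) 0 xs)
    bound (x ∷ xs) (here g≗x) = ℕ.s≤s (ℕ.≤-trans (ℕ.≤-reflexive (cong value (g≗x 1⁺))) (ℕ.m≤m⊔n _ _))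
    bound (x ∷ xs) (there g∈) = ℕ.≤-trans (bound xs g∈) (ℕ.s≤s (ℕ.m≤n⊔m _ _))

  enlarge : 𝒫f ℕ⁺^ℕ⁺ → 𝒫f ℕ⁺^ℕ⁺
  enlarge F = F Functions.∪f Functions.singleton (fresh F)

  ⊊-enlarge : ∀ F → F ⊊f enlarge F
  ⊊-enlarge F = (λ {x} → ∪f-⊆ˡ F (singleton (fresh F)) {x})
    , λ ⊆F → fresh∉ F (⊆F {fresh F} (∪f-⊆ʳ F (singleton (fresh F)) {fresh F} (∈-singleton (fresh F))))
    where open Functions

  -- Images under injections

  relabel : {g : ℕ⁺ → ℕ⁺} → (∀ {i j} → g i ≡ g j → i ≡ j) → 𝒫f ℕ⁺-setoid → 𝒫f ℕ⁺-setoid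
  relabel {g} inj (finset (x ∷ xs) u) = finset (g x ∷ List.map g xs) (Unique.map⁺ inj u)

  module _ {g : ℕ⁺ → ℕ⁺} (inj : ∀ {i j} → g i ≡ g j → i ≡ j) where

    ∈-relabel : ∀ β {x} → x ∈f relabel inj β → ∃[ y ] y ∈f β × x ≡ g y
    ∈-relabel (finset (_ ∷ _) _) = ∈-map⁻ g

    total-relabel : ∀ β f → total f (toList (elements (relabel inj β))) ≡ total (f ∘ g) (toList (elements β))
    total-relabel (finset (x ∷ xs) _) f = cong sum (sym (map-∘ {g = value ∘ f} {g} (x ∷ xs)))

    ∑-relabel : ∀ β f → ∑ (relabel inj β) f ≡ ∑ β (f ∘ g)
    ∑-relabel β f = ℕ⁺-≡ (trans (value-∑ (relabel inj β) f) (trans (total-relabel β f) (sym (value-∑ β (f ∘ g)))))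

  module βℕ⁺ = Semigroup _+⁺_ +⁺-assoc

  -- Iterated tensor powers

  -- The first coordinate is split off, whereas `⨂` splits off the last: tuples of block sums are
  -- treated from the left. The two forms are compared at the end.
  tensor : Ultra ℕ⁺ → ∀ n → (Vec ℕ⁺ n → Bool) → Bool
  tensor p zero    A = A []
  tensor p (suc n) A = fam p λ x → tensor p n λ xs → A (x ∷ xs)

  -- Sums along chains of finite sets of functions

  FunSet : Set
  FunSet = 𝒫f ℕ⁺^ℕ⁺

  module Chains {X : Set} (_∙_ : X → X → X) (assoc : ∀ x y z → (x ∙ y) ∙ z ≡ x ∙ (y ∙ z))
    (Step : FunSet → X → Set)
    (step : ∀ F → ∃[ G ] F ⊊f G × ∃[ x ] Step G x)
    where

    open Semigroup _∙_ assoc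

    -- F only bounds the chain from below and contributes no term, so a path ending in G can be
    -- followed by one starting from G.
    data Path (F : FunSet) : X → FunSet → Set where
      one  : ∀ {G x} → F ⊊f G → Step G x → Path F x G
      more : ∀ {G K x y} → F ⊊f G → Step G x → Path G y K → Path F (x ∙ y) K

    weaken : ∀ {E F x K} → E ⊆f F → Path F x K → Path E x K
    weaken {E} {F} E⊆F (one {G} F⊊G s)    = one (⊊f-trans {E = E} {F} {G} (λ {f} → E⊆F {f}) F⊊G) s
    weaken {E} {F} E⊆F (more {G} F⊊G s P) = more (⊊f-trans {E = E} {F} {G} (λ {f} → E⊆F {f}) F⊊G) s P

    _◅◅_ : ∀ {F x G y K} → Path F x G → Path G y K → Path F (x ∙ y) K
    one F⊊G s ◅◅ Q                = more F⊊G s Q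
    more {x = x} {y} F⊊G s P ◅◅ Q = subst (λ z → Path _ z _) (sym (assoc x y _)) (more F⊊G s (P ◅◅ Q))

    tails : Family X
    tails A = ⌊ (∃[ F ] (∀ {x K} → Path F x K → T (A x))) ⌋

    tails-filter : IsFilter tails
    tails-filter = record
      { whole     = into (Functions.singleton (λ t → t) , λ _ → tt)
      ; inhabited = λ a → let F , h = out a ; G , F⊊G , x , s = step F in x , h (one F⊊G s)
      ; up        = λ A⊆B a → let F , h = out a in into (F , λ P → A⊆B _ (h P))
      ; meet      = λ A∩B⊆C a b → let F , h = out a ; G , k = out b in into
          ( F Functions.∪f G
          , λ P → A∩B⊆C _ (h (weaken (λ {f} → Functions.∪f-⊆ˡ F G {f}) P))
                           (k (weaken (λ {f} → Functions.∪f-⊆ʳ F G {f}) P)) )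
      }

    -- The final set K of a path serves as the bound for its continuations. It varies with the path,
    -- as the order of quantifiers in a product of ultrafilters allows.
    tails-absorbs : Absorbs tails tails
    tails-absorbs A a q tails⊑q = let F , h = out a in
      into (F , λ {x} {K} P → tails⊑q _ (into (K , λ Q → h (P ◅◅ Q))))

    data Blocks (F : FunSet) : ∀ {n} → Vec X n → Set where
      []  : Blocks F []
      _∷_ : ∀ {n x K} {xs : Vec X n} → Path F x K → Blocks K xs → Blocks F (x ∷ xs)

  -- Formal sums and their evaluation

  _⊞_ : ℕ⁺ → ℕ → ℕ⁺
  a ⊞ zero  = a
  a ⊞ suc n = a +⁺ (suc n , [ _ ])

  value-⊞ : ∀ a n → value (a ⊞ n) ≡ value a ℕ.+ n
  value-⊞ a zero    = sym (ℕ.+-identityʳ (value a))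
  value-⊞ a (suc n) = refl

  -- An element (a , β) of this semigroup stands for the functional f ↦ a + Σ_{t ∈ β} f(t).
  Functional : Set
  Functional = ℕ⁺ × List ℕ⁺

  _⊹_ : Functional → Functional → Functional
  (a , β) ⊹ (b , γ) = a +⁺ b , β ++ γ

  ⊹-assoc : ∀ x y z → (x ⊹ y) ⊹ z ≡ x ⊹ (y ⊹ z)
  ⊹-assoc (a , β) (b , γ) (c , δ) = cong₂ _,_ (+⁺-assoc a b c) (++-assoc β γ δ)

  eval : (ℕ⁺ → ℕ⁺) → Functional → ℕ⁺
  eval f (a , β) = a ⊞ total f β

  eval-⊹ : ∀ f x y → eval f (x ⊹ y) ≡ eval f x +⁺ eval f y
  eval-⊹ f (a , β) (b , γ) = ℕ⁺-≡ (begin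
    value ((a +⁺ b) ⊞ total f (β ++ γ))                         ≡⟨ value-⊞ (a +⁺ b) _ ⟩
    value a ℕ.+ value b ℕ.+ total f (β ++ γ)                    ≡⟨ cong (value a ℕ.+ value b ℕ.+_) total-++ ⟩
    value a ℕ.+ value b ℕ.+ (total f β ℕ.+ total f γ)           ≡⟨ interchange (value a) (value b) _ _ ⟩
    (value a ℕ.+ total f β) ℕ.+ (value b ℕ.+ total f γ)         ≡⟨ cong₂ ℕ._+_ (value-⊞ a _) (value-⊞ b _) ⟨
    value (eval f (a , β)) ℕ.+ value (eval f (b , γ))           ∎)
    where
    open ≡-Reasoning
    open CommutativeSemigroup ℕ.+-commutativeSemigroup using (interchange)
    total-++ : total f (β ++ γ) ≡ total f β ℕ.+ total f γ
    total-++ = trans (cong sum (map-++ (value ∘ f) β γ)) (sum-++ (List.map (value ∘ f) β) _)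

  eval-∑ : ∀ f a β → eval f (a , toList (elements β)) ≡ a +⁺ ∑ β f
  eval-∑ f a β = ℕ⁺-≡ (trans (value-⊞ a _) (cong (value a ℕ.+_) (sym (value-∑ β f))))

  nonempty : Functional → Bool
  nonempty (_ , [])    = false
  nonempty (_ , _ ∷ _) = true

  nonempty-⊹ˡ : ∀ x y → T (nonempty x) → T (nonempty (x ⊹ y))
  nonempty-⊹ˡ (_ , _ ∷ _) _ _ = tt

  nonempty-⊹ʳ : ∀ x y → T (nonempty y) → T (nonempty (x ⊹ y))
  nonempty-⊹ʳ (_ , [])    (_ , _ ∷ _) _ = tt
  nonempty-⊹ʳ (_ , _ ∷ _) _           _ = tt

  constant : ℕ⁺ → Functional
  constant a = a , []

  -- From α and H to an idempotent whose members are J-sets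

  module FromChoices
    (α : FunSet → ℕ⁺) (H : FunSet → 𝒫f ℕ⁺-setoid)
    (H-increasing : ∀ F G → F ⊊f G → max (H F) < min (H G))
    where

    term : FunSet → (ℕ⁺ → ℕ⁺) → ℕ⁺
    term G f = α G +⁺ ∑ (H G) f

    data Value (G : FunSet) : ℕ⁺ → Set where
      at : ∀ {f} → f ∈f G → Value G (term G f)

    value-step : ∀ F → ∃[ G ] F ⊊f G × ∃[ x ] Value G x
    value-step F = enlarge F , ⊊-enlarge F , _ , at (Functions.head∈ (enlarge F))

    open Chains _+⁺_ +⁺-assoc Value value-step

    open βℕ⁺

    opaque
      minIdem : MinimalIdempotent tails
      minIdem = minimalIdempotent tails-filter tails-absorbs

    open MinimalIdempotent minIdem

    tails⊑point : tails ⊑ fam point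
    tails⊑point A a = ideal⊑point A (Q⊑ideal A a)

    module _ (F₀ : FunSet) where

      -- A `varied` step leaves the function open. As `F₀` is contained in G, any f in `F₀` may be
      -- inserted, and evaluation gives a `Value` of G.
      data Choice (G : FunSet) : Functional → Set where
        fixed  : ∀ {f} → f ∈f G → Choice G (constant (term G f))
        varied : F₀ ⊆f G → Choice G (α G , toList (elements (H G)))

      choice-step : ∀ F → ∃[ G ] F ⊊f G × ∃[ x ] Choice G x
      choice-step F = enlarge F , ⊊-enlarge F , _ , fixed (Functions.head∈ (enlarge F))

      private
        module E = Chains _⊹_ ⊹-assoc Choice choice-step
        module S = Semigroup _⊹_ ⊹-assoc

      eval-Choice : ∀ {f G x} → f ∈f F₀ → Choice G x → Value G (eval f x)
      eval-Choice f∈ (fixed g∈)           = at g∈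
      eval-Choice {f} {G} f∈ (varied F₀⊆G) = subst (Value G) (sym (eval-∑ f (α G) (H G))) (at (F₀⊆G {f} f∈))

      eval-Path : ∀ {f G x K} → f ∈f F₀ → E.Path G x K → Path G (eval f x) K
      eval-Path f∈ (E.one G⊊K s) = one G⊊K (eval-Choice f∈ s)
      eval-Path {f} f∈ (E.more {x = x} {y} G⊊K s P) =
        subst (λ z → Path _ z _) (sym (eval-⊹ f x y)) (more G⊊K (eval-Choice f∈ s) (eval-Path f∈ P))

      constant-Path : ∀ {G x K} → Path G x K → E.Path G (constant x) K
      constant-Path (one G⊊K (at f∈))    = E.one G⊊K (fixed f∈)
      constant-Path (more G⊊K (at f∈) P) = E.more G⊊K (fixed f∈) (constant-Path P)

      -- Since H increases along chains, the index sets met by a path are disjoint.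
      Path-unique : ∀ {G x K} → E.Path G x K → Unique (proj₂ x) × All (λ t → max (H G) < value t) (proj₂ x)
      Path-unique (E.one G⊊K (fixed _)) = [] , []
      Path-unique {G} {K = K} (E.one G⊊K (varied _)) = distinct (H K) ,
        All.tabulate λ t∈ → ℕ.<-≤-trans (H-increasing G K G⊊K) (min-≤ (H K) t∈)
      Path-unique {G} (E.more {G′} G⊊G′ (fixed _) P) =
        let u , above = Path-unique P in
        u , All.map (ℕ.<-trans (ℕ.<-≤-trans (H-increasing G G′ G⊊G′) (min≤max (H G′)))) above
      Path-unique {G} (E.more {G′} {y = _ , γ} G⊊G′ (varied _) P) =
          Unique.++⁺ (distinct (H G′)) (proj₁ (Path-unique P))
            (λ (t∈ , t∈γ) → ℕ.<-irrefl refl (ℕ.<-≤-trans (All.lookup above t∈γ) (≤-max (H G′) t∈)))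
        , All.tabulate (λ t∈ → [ below , beyond ]′ (∈-++⁻ (toList (elements (H G′))) t∈))
        where
        above = proj₂ (Path-unique P)
        below : ∀ {t} → t ∈f H G′ → max (H G) < value t
        below t∈ = ℕ.<-≤-trans (H-increasing G G′ G⊊G′) (min-≤ (H G′) t∈)
        beyond : ∀ {t} → t ∈ₗ γ → max (H G) < value t
        beyond t∈γ = ℕ.<-trans (ℕ.<-≤-trans (H-increasing G G′ G⊊G′) (min≤max (H G′))) (All.lookup above t∈γ)

      -- Each clause asks that certain sets belong to r, so the condition is closed; being preserved
      -- by products too, it admits an idempotent. The first clause keeps r on paths, where index
      -- lists have no repetitions.
      Admissible : Ultra Functional → Set
      Admissible r = E.tails ⊑ fam r × T (fam r nonempty) × (∀ f → f ∈f F₀ → ideal ⊑ fam (image (eval f) r))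

      eval-· : ∀ f r q → fam (image (eval f) (r S.· q)) ≗ fam (image (eval f) r · image (eval f) q)
      eval-· f r q A = fam-cong r λ x → fam-cong q λ y → cong A (eval-⊹ f x y)

      tails⊑eval : ∀ {f} r → f ∈f F₀ → E.tails ⊑ fam r → tails ⊑ fam (image (eval f) r)
      tails⊑eval r f∈ tails⊑r A a = let G , h = out a in tails⊑r _ (into (G , h ∘ eval-Path f∈))

      δ : Ultra Functional
      δ = image constant point

      tails⊑δ : E.tails ⊑ fam δ
      tails⊑δ A a = let G , h = out a in tails⊑point _ (into (G , h ∘ constant-Path))

      -- Proper because above every F there is a set that also contains `F₀`, and a `varied` step
      -- there contributes a nonempty index list.
      nonempty-tails : IsFilter λ A → ⌊ (∃[ F ] (∀ {x K} → E.Path F x K → T (nonempty x) → T (A x))) ⌋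
      nonempty-tails = record
        { whole     = into (F₀ , λ _ _ → tt)
        ; inhabited = λ a → let F , h = out a in _ , h (E.one {G = enlarge (F Functions.∪f F₀)}
            (⊊f-trans {E = F} {F Functions.∪f F₀} {enlarge (F Functions.∪f F₀)}
              (λ {f} → Functions.∪f-⊆ˡ F F₀ {f}) (⊊-enlarge (F Functions.∪f F₀)))
            (varied λ {f} f∈ → proj₁ (⊊-enlarge (F Functions.∪f F₀)) {f} (Functions.∪f-⊆ʳ F F₀ {f} f∈))) tt
        ; up        = λ A⊆B a → let F , h = out a in into (F , λ P n → A⊆B _ (h P n))
        ; meet      = λ A∩B⊆C a b → let F , h = out a ; G , k = out b in into
            ( F Functions.∪f G
            , λ P n → A∩B⊆C _ (h (E.weaken (λ {f} → Functions.∪f-⊆ˡ F G {f}) P) n)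
                               (k (E.weaken (λ {f} → Functions.∪f-⊆ʳ F G {f}) P) n) )
        }

      -- The factor s makes the index list nonempty. The factor δ moves the evaluations into the
      -- ideal: each `eval f` maps δ to `point` by computation, and `ideal` absorbs the image of s
      -- on its left.
      admissible : Σ (Ultra Functional) Admissible
      admissible = s S.· δ
        , S.absorbs-· E.tails-absorbs s δ tails⊑s tails⊑δ
        , Ultra.up s (λ x n → Ultra.up δ {λ _ → true} (λ y _ → nonempty-⊹ˡ x y n) (Ultra.whole point)) ne∈s
        , λ f f∈ A a → T-resp (sym (eval-· f s δ A))
            (absorbs-· ideal-absorbs (image (eval f) s) point (tails⊑eval s f∈ tails⊑s) ideal⊑point A a)
        where
        extension = ultrafilter-lemma nonempty-tails
        s = proj₁ extension
        tails⊑s : E.tails ⊑ fam s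
        tails⊑s A a = let F , h = out a in proj₂ extension A (into (F , λ P _ → h P))
        ne∈s : T (fam s nonempty)
        ne∈s = proj₂ extension nonempty (into (F₀ , λ _ n → n))

      admissible-closed : ∀ q → closure Admissible ⊑ fam q → Admissible q
      admissible-closed q Ad⊑q =
          (λ A a → Ad⊑q A (into λ r (tails⊑r , _) → tails⊑r A a))
        , Ad⊑q nonempty (into λ r (_ , ne∈r , _) → ne∈r)
        , λ f f∈ A a → Ad⊑q _ (into λ r (_ , _ , ideal⊑r) → ideal⊑r f f∈ A a)

      admissible-· : ∀ r q → Admissible r → Admissible q → Admissible (r S.· q)
      admissible-· r q (tails⊑r , ne∈r , _) (tails⊑q , _ , ideal⊑q) =
          S.absorbs-· E.tails-absorbs r q tails⊑r tails⊑q
        , Ultra.up r (λ x n → Ultra.up q {λ _ → true} (λ y _ → nonempty-⊹ˡ x y n) (Ultra.whole q)) ne∈r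
        , λ f f∈ A a → T-resp (sym (eval-· f r q A))
            (absorbs-· ideal-absorbs (image (eval f) r) (image (eval f) q) (tails⊑eval r f∈ tails⊑r) (ideal⊑q f f∈) A a)

      module _ (B : ℕ⁺ → Bool) (e : Ultra Functional) (tails⊑e : E.tails ⊑ fam e) (ne∈e : T (fam e nonempty))
        (B∈e : ∀ f → f ∈f F₀ → T (fam e λ x → B (eval f x))) where

        private
          module e = Ultra e

          InB : List (ℕ⁺ → ℕ⁺) → Functional → Set
          InB fs x = ∀ f → Membership._∈_ ℕ⁺^ℕ⁺ f fs → T (B (eval f x))

          InB-∷ : ∀ {g gs} x → T (B (eval g x)) → InB gs x → InB (g ∷ gs) x
          InB-∷ (a , β) Bg Bgs f (here f≗g) =
            T-resp (cong (λ n → B (a ⊞ sum n)) (sym (map-cong (cong value ∘ f≗g) β))) Bg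
          InB-∷ _       Bg Bgs f (there f∈) = Bgs f f∈

          InB∈e : ∀ fs → (∀ f → Membership._∈_ ℕ⁺^ℕ⁺ f fs → T (fam e λ x → B (eval f x))) → T (fam e λ x → ⌊ InB fs x ⌋)
          InB∈e []       _ = e.up (λ _ _ → into λ _ ()) e.whole
          InB∈e (g ∷ gs) h = e.meet (λ x Bg Bgs → into (InB-∷ {g} {gs} x Bg (out Bgs)))
            (h g (here λ _ → refl)) (InB∈e gs λ f f∈ → h f (there f∈))

          OnPath : Functional → Set
          OnPath x = T (nonempty x) × ∃[ K ] E.Path F₀ x K

          found : ∃[ x ] T ⌊ (InB (toList (elements F₀)) x × OnPath x) ⌋
          found = e.inhabited (e.meet {λ x → ⌊ InB (toList (elements F₀)) x ⌋} {λ x → ⌊ OnPath x ⌋}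
            (λ _ b c → into (out b , out c)) (InB∈e (toList (elements F₀)) B∈e)
            (e.meet {C = λ x → ⌊ OnPath x ⌋} (λ _ n P → into (n , out P)) ne∈e
              (tails⊑e (λ x → ⌊ (∃[ K ] E.Path F₀ x K) ⌋) (into (F₀ , λ {x} {K} P → into (K , P))))))

          read-off : ∀ {x} → InB (toList (elements F₀)) x × OnPath x →
            Σ ℕ⁺ λ a → Σ (𝒫f ℕ⁺-setoid) λ β → ∀ f → f ∈f F₀ → T (B (a +⁺ ∑ β f))
          read-off {a , t ∷ ts} (in-B , _ , _ , P) = a , β , λ f f∈ → T-resp (cong B (eval-∑ f a β)) (in-B f f∈)
            where
            β = finset (t ∷ ts) (proj₁ (Path-unique P))

        -- As `F₀` is finite, the conditions at its members meet in one set of e. Some path with a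
        -- nonempty index list lies in it, and `Path-unique` turns that list into a `𝒫f`.
        extract : Σ ℕ⁺ λ a → Σ (𝒫f ℕ⁺-setoid) λ β → ∀ f → f ∈f F₀ → T (B (a +⁺ ∑ β f))
        extract = read-off (out (proj₂ found))

      -- For an admissible idempotent r, the ultrafilter δ · r is mapped to the minimal
      -- idempotent by every f ∈ F₀ at once.
      point-J : ∀ B → T (fam point B) → Σ ℕ⁺ λ a → Σ (𝒫f ℕ⁺-setoid) λ β → ∀ f → f ∈f F₀ → T (B (a +⁺ ∑ β f))
      point-J B pB = extract B (δ S.· r)
        (S.absorbs-· E.tails-absorbs δ r tails⊑δ tails⊑r)
        (Ultra.up δ {λ _ → true} (λ x _ → Ultra.up r (λ y → nonempty-⊹ʳ x y) ne∈r) (Ultra.whole point))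
        λ f f∈ → T-resp (sym (trans (eval-· f δ r B) (right-unit (image (eval f) r) (ideal⊑r f f∈)
          (λ A → trans (sym (eval-· f r r A)) (rr≈r _)) B))) pB
        where
        idem : Σ (Ultra Functional) λ r → Admissible r × r S.· r S.≈ r
        idem = S.idempotent-in Admissible admissible admissible-closed admissible-·
        r = proj₁ idem
        tails⊑r = proj₁ (proj₁ (proj₂ idem))
        ne∈r = proj₁ (proj₂ (proj₁ (proj₂ idem)))
        ideal⊑r = proj₂ (proj₂ (proj₁ (proj₂ idem)))
        rr≈r = proj₂ (proj₂ idem)

    -- Each coordinate ranges over a member of `tails`; the end K of one block is the lower bound
    -- for the next.
    tensor-Blocks : ∀ n (A : Vec ℕ⁺ n → Bool) F → (∀ xs → Blocks F xs → T (A xs)) → T (tensor point n A)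
    tensor-Blocks zero    A F h = h [] []
    tensor-Blocks (suc n) A F h = tails⊑point _
      (into (F , λ {x} {K} P → tensor-Blocks n (λ xs → A (x ∷ xs)) K λ xs Ps → h (x ∷ xs) (P ∷ Ps)))

  -- Sequences indexed by the positive integers

  module _ {X : Set} where

    prepend : X → (ℕ⁺ → X) → ℕ⁺ → X
    prepend x s (suc (suc n) , _) = s (suc n , [ _ ])
    prepend x s _                 = x

    prepend-suc⁺ : ∀ x s i → prepend x s (suc⁺ i) ≡ s i
    prepend-suc⁺ x s (suc n , _) = refl
    prepend-suc⁺ x s i@(zero , _) = ⊥-elim (ℕ.<-irrefl refl (value>0 i))

    prepend-∀ : ∀ {x} {s : ℕ⁺ → X} (P : ℕ⁺ → X → Set) → P 1⁺ x → (∀ i → P (suc⁺ i) (s i)) → ∀ i → P i (prepend x s i)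
    prepend-∀ P p ps (suc zero , _)    = p
    prepend-∀ P p ps (suc (suc n) , _) = ps (suc n , [ _ ])
    prepend-∀ P p ps i@(zero , _)      = ⊥-elim (ℕ.<-irrefl refl (value>0 i))

  suc⁺-injective : ∀ {i j} → suc⁺ i ≡ suc⁺ j → i ≡ j
  suc⁺-injective e = ℕ⁺-≡ (ℕ.suc-injective (cong value e))

  shift : 𝒫f ℕ⁺-setoid → 𝒫f ℕ⁺-setoid
  shift = relabel suc⁺-injective

  first : 𝒫f ℕ⁺-setoid
  first = finset (1⁺ ∷ []) ([] ∷ [])

  with-first : 𝒫f ℕ⁺-setoid → 𝒫f ℕ⁺-setoid
  with-first β = finset (1⁺ ∷ toList (elements (shift β))) (All.tabulate 1≢ ∷ distinct (shift β))
    where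
    1≢ : ∀ {x} → x ∈f shift β → 1⁺ ≢ x
    1≢ x∈ refl with ∈-relabel suc⁺-injective β x∈
    ... | y , _ , 1≡ = ℕ.<-irrefl (ℕ.suc-injective (cong value 1≡)) (value>0 y)

  ∑-with-first : ∀ β g → ∑ (with-first β) g ≡ g 1⁺ +⁺ ∑ β (g ∘ suc⁺)
  ∑-with-first β g = ℕ⁺-≡ (trans (value-∑ (with-first β) g)
    (cong (value (g 1⁺) ℕ.+_) (trans (total-relabel suc⁺-injective β g) (sym (value-∑ β (g ∘ suc⁺))))))

  shift-< : ∀ {β γ} → β <f γ → shift β <f shift γ
  shift-< {β} {γ} β<γ = <f-intro {shift β} {shift γ} λ x∈ y∈ → lt (∈-relabel suc⁺-injective β x∈) (∈-relabel suc⁺-injective γ y∈)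
    where
    lt : ∀ {x y} → ∃[ x′ ] x′ ∈f β × x ≡ suc⁺ x′ → ∃[ y′ ] y′ ∈f γ × y ≡ suc⁺ y′ → value x < value y
    lt (_ , x∈ , refl) (_ , y∈ , refl) = ℕ.s<s (<f-elim {β} {γ} β<γ x∈ y∈)

  first-<-shift : ∀ γ → first <f shift γ
  first-<-shift γ = <f-intro {first} {shift γ} λ { (here refl) y∈ → lt (∈-relabel suc⁺-injective γ y∈) }
    where
    lt : ∀ {y} → ∃[ y′ ] y′ ∈f γ × y ≡ suc⁺ y′ → 1 < value y
    lt (y , _ , refl) = ℕ.s<s (value>0 y)

  with-first-<-shift : ∀ {β γ} → β <f γ → with-first β <f shift γ
  with-first-<-shift {β} {γ} β<γ = <f-intro {with-first β} {shift γ} λ where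
    (here refl) y∈ → <f-elim {first} {shift γ} (first-<-shift γ) (here refl) y∈
    (there x∈)  y∈ → <f-elim {shift β} {shift γ} (shift-< {β} {γ} β<γ) x∈ y∈

  -- Tuples of path sums realised along one infinite chain

  module Realisation
    (α : FunSet → ℕ⁺) (H : FunSet → 𝒫f ℕ⁺-setoid)
    (H-increasing : ∀ F G → F ⊊f G → max (H F) < min (H G))
    where

    open FromChoices α H H-increasing
    open Chains _+⁺_ +⁺-assoc Value value-step
    open βℕ⁺
    open MinimalIdempotent minIdem using (point)

    private
      v : FunSet × (ℕ⁺ → ℕ⁺) → ℕ⁺
      v (G , f) = term G f

    -- Condition (b) speaks of infinite chains, whereas a tuple of blocks uses a finite one. Here
    -- that chain is embedded in an infinite one, together with the indices that form each block.
    record Sequence (F : FunSet) {n} (xs : Vec ℕ⁺ n) : Set where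
      field
        steps    : ℕ⁺ → FunSet × (ℕ⁺ → ℕ⁺)
        start    : F ⊊f proj₁ (steps 1⁺)
        climb    : ∀ i → proj₁ (steps i) ⊊f proj₁ (steps (suc⁺ i))
        member   : ∀ i → proj₂ (steps i) ∈f proj₁ (steps i)
        blocks   : Fin n → 𝒫f ℕ⁺-setoid
        blocks-< : ∀ i j → i Fin.< j → blocks i <f blocks j
        sums     : ∀ j → ∑ (blocks j) (v ∘ steps) ≡ lookup xs j

    module _ {F G : FunSet} {g} (F⊊G : F ⊊f G) (g∈G : g ∈f G) {n} {xs : Vec ℕ⁺ n} (S : Sequence G xs) where
      private
        module S = Sequence S
        steps′ = prepend (G , g) S.steps

      prepend-step : ∀ {m} {ys : Vec ℕ⁺ m} (blocks′ : Fin m → 𝒫f ℕ⁺-setoid) →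
        (∀ i j → i Fin.< j → blocks′ i <f blocks′ j) →
        (∀ j → ∑ (blocks′ j) (v ∘ steps′) ≡ lookup ys j) → Sequence F ys
      prepend-step blocks′ blocks-<′ sums′ = record
        { steps    = steps′
        ; start    = F⊊G
        ; climb    = prepend-∀ (λ i s → proj₁ s ⊊f proj₁ (steps′ (suc⁺ i))) S.start S.climb
        ; member   = prepend-∀ (λ _ s → proj₂ s ∈f proj₁ s) g∈G S.member
        ; blocks   = blocks′
        ; blocks-< = blocks-<′
        ; sums     = sums′
        }

      sum-shift : ∀ β → ∑ (shift β) (v ∘ steps′) ≡ ∑ β (v ∘ S.steps)
      sum-shift β = trans (∑-relabel suc⁺-injective β (v ∘ steps′)) (∑-cong β λ i → cong v (prepend-suc⁺ (G , g) S.steps i))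

      -- The prepended step gets index 1 and forms a block of its own; all other indices move up by
      -- one.
      new-block : Sequence F (term G g ∷ xs)
      new-block = prepend-step
        (λ { zero → first ; (suc j) → shift (S.blocks j) })
        (λ { zero (suc j) _ → first-<-shift (S.blocks j)
           ; (suc i) (suc j) (ℕ.s≤s i<j) → shift-< {S.blocks i} {S.blocks j} (S.blocks-< i j i<j) })
        (λ { zero → refl ; (suc j) → trans (sum-shift (S.blocks j)) (S.sums j) })

    -- Here index 1 joins the first existing block, prolonging it on the left.
    extend-block : ∀ {F G g n x} {xs : Vec ℕ⁺ n} → F ⊊f G → g ∈f G → Sequence G (x ∷ xs) → Sequence F ((term G g +⁺ x) ∷ xs)
    extend-block {F} {G} {g} F⊊G g∈G S = prepend-step F⊊G g∈G S
      (λ { zero → with-first (S.blocks zero) ; (suc j) → shift (S.blocks (suc j)) })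
      (λ { zero (suc j) _ → with-first-<-shift {S.blocks zero} {S.blocks (suc j)} (S.blocks-< zero (suc j) ℕ.z<s)
         ; (suc i) (suc j) (ℕ.s≤s i<j) →
             shift-< {S.blocks (suc i)} {S.blocks (suc j)} (S.blocks-< (suc i) (suc j) (ℕ.s<s i<j)) })
      (λ { zero → trans (∑-with-first (S.blocks zero) _) (cong (term G g +⁺_)
             (trans (∑-cong (S.blocks zero) λ i → cong v (prepend-suc⁺ (G , g) S.steps i)) (S.sums zero)))
         ; (suc j) → trans (sum-shift {F = F} F⊊G g∈G S (S.blocks (suc j))) (S.sums (suc j)) })
      where module S = Sequence S

    enlargements : FunSet → ℕ → FunSet
    enlargements F zero    = F
    enlargements F (suc n) = enlarge (enlargements F n)

    trivial-sequence : ∀ F → Sequence F []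
    trivial-sequence F = record
      { steps    = λ i → set i , List⁺.head (elements (set i))
      ; start    = ⊊-enlarge F
      ; climb    = λ i → ⊊-enlarge (set i)
      ; member   = λ i → Functions.head∈ (set i)
      ; blocks   = λ ()
      ; blocks-< = λ ()
      ; sums     = λ ()
      }
      where
      set : ℕ⁺ → FunSet
      -- `value i` is at least 1, so already the first set is strictly above F.
      set i = enlargements F (value i)

    path-sequence : ∀ {F x K n} {xs : Vec ℕ⁺ n} → Path F x K → Sequence K xs → Sequence F (x ∷ xs)
    path-sequence (one F⊊G (at g∈G))    S = new-block F⊊G g∈G S
    path-sequence (more F⊊G (at g∈G) P) S = extend-block F⊊G g∈G (path-sequence P S)

    sequence : ∀ {F n} {xs : Vec ℕ⁺ n} → Blocks F xs → Sequence F xs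
    sequence {F} []  = trivial-sequence F
    sequence (P ∷ Ps) = path-sequence P (sequence Ps)

    module _ {m} (A : Vec ℕ⁺ m → Bool)
      (sums∈A : ∀ (G : ℕ⁺ → FunSet) → (∀ i → G i ⊊f G (i +⁺ 1⁺)) →
         ∀ (β : Fin m → 𝒫f ℕ⁺-setoid) → (∀ {i j} → i Fin.< j → β i <f β j) →
         ∀ (f : ℕ⁺ → ℕ⁺ → ℕ⁺) → (∀ i → f i ∈f G i) →
         T (A (tabulate λ j → ∑[ i ∈ β j ] term (G i) (f i))))
      where

      Blocks⇒A : ∀ {F} xs → Blocks F xs → T (A xs)
      Blocks⇒A xs Ps = subst (λ ys → T (A ys)) (trans (tabulate-cong sums) (tabulate∘lookup xs))
        (sums∈A (proj₁ ∘ steps) (λ i → subst (λ j → proj₁ (steps i) ⊊f proj₁ (steps j)) (sym (+1⁺ i)) (climb i))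
          blocks (λ {i} {j} → blocks-< i j) (proj₂ ∘ steps) member)
        where open Sequence (sequence Ps)

      A∈tensor : T (tensor point m A)
      A∈tensor = tensor-Blocks m A (Functions.singleton (λ t → t)) Blocks⇒A

  -- Cardinalities and enumeration of subsets

  module _ (S : Setoid 0ℓ 0ℓ) where
    open Setoid S using (Carrier; _≈_)
    private
      module M = Membership S

    unique-lookup : ∀ {xs} → Uniqueₛ S xs → ∀ i j → List.lookup xs i ≈ List.lookup xs j → i ≡ j
    unique-lookup (_ ∷ _)  zero    zero    _   = refl
    unique-lookup (x≉ ∷ _) zero    (suc j) x≈y = ⊥-elim (All.lookup x≉ (∈-lookup j) x≈y)
    unique-lookup (x≉ ∷ _) (suc i) zero    y≈x = ⊥-elim (All.lookup x≉ (∈-lookup i) (Setoid.sym S y≈x))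
    unique-lookup (_ ∷ u)  (suc i) (suc j) x≈y = cong suc (unique-lookup u i j x≈y)

    unique-length-≤ : ∀ {xs ys} → Uniqueₛ S xs → (∀ {x} → x M.∈ xs → x M.∈ ys) → List.length xs ≤ List.length ys
    unique-length-≤ {xs} u xs⊆ys = injective⇒≤ {f = λ i → Any.index (member i)} λ {i} {j} e →
      unique-lookup u i j (Mem.index-injective S (member i) (member j) e)
      where
      member : ∀ i → List.lookup xs i M.∈ _
      member i = xs⊆ys (Mem.∈-lookup S _ i)

    size : 𝒫f S → ℕ
    size F = List.length (toList (elements F))

    ⊊⇒size-< : ∀ F G → F ⊊f G → size F < size G
    ⊊⇒size-< F G (F⊆G , G⊈F) = by-contradiction λ ¬< → G⊈F λ {y} y∈G → by-contradiction λ y∉F →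
      ¬< (unique-length-≤ (¬Any⇒All¬ _ y∉F ∷ distinct F) (insert y∈G))
      where
      insert : ∀ {y} → y ∈f G → ∀ {x} → x M.∈ (y ∷ toList (elements F)) → x ∈f G
      insert y∈G (here x≈y) = Mem.∈-resp-≈ S (Setoid.sym S x≈y) y∈G
      insert y∈G (there x∈) = F⊆G x∈

    -- Different lists may denote the same set, and α and H must not distinguish them; they are
    -- therefore computed from canonical lists.
    canonical : 𝒫f S → 𝒫f S
    canonical = canon (𝒫f-setoid S)

    ⊆-canonical : ∀ F → F ⊆f canonical F
    ⊆-canonical F {x} = proj₁ (canon-≈ (𝒫f-setoid S) F) {x}

    canonical-⊆ : ∀ F → canonical F ⊆f F
    canonical-⊆ F {x} = proj₂ (canon-≈ (𝒫f-setoid S) F) {x}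

    sublists : List Carrier → List (List Carrier)
    sublists []       = [] ∷ []
    sublists (x ∷ xs) = List.map (x ∷_) (sublists xs) ++ sublists xs

    filter∈sublists : ∀ {P : Carrier → Set} (P? : ∀ x → Dec (P x)) xs → filter P? xs ∈ₗ sublists xs
    filter∈sublists P? []       = here refl
    filter∈sublists P? (x ∷ xs) with P? x
    ... | yes _ = ∈-++⁺ˡ (∈-map⁺ (x ∷_) (filter∈sublists P? xs))
    ... | no _  = ∈-++⁺ʳ (List.map (x ∷_) (sublists xs)) (filter∈sublists P? xs)

    module _ (F : 𝒫f S) where

      private
        Names : List Carrier → Set
        Names ys = ∃[ G ] G ⊊f F × toList (elements G) ≡ ys

        named : ∀ {ys} → Dec (Names ys) → List (𝒫f S)
        named (yes (G , _)) = canonical G ∷ []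
        named (no _)        = []

        named-sound : ∀ {ys K} (d : Dec (Names ys)) → K ∈ₗ named d → ∃[ G ] G ⊊f F × K ≡ canonical G
        named-sound (yes (G , G⊊F , _)) (here K≡) = G , G⊊F , K≡

        named-complete : ∀ {ys G} (d : Dec (Names ys)) → G ⊊f F → toList (elements G) ≡ ys → canonical G ∈ₗ named d
        -- `lem` may supply another set G′ with the same list, but canonical forms depend only on
        -- the elements.
        named-complete {G = G} (yes (G′ , _ , refl)) G⊊F e = here (canon-cong (𝒫f-setoid S)
          ((λ {x} → subst (λ zs → x M.∈ zs) e) , (λ {x} → subst (λ zs → x M.∈ zs) (sym e))))
        named-complete {G = G} (no ¬names) G⊊F e = ⊥-elim (¬names (G , G⊊F , e))

      opaque
        properSubsets : List (𝒫f S)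
        properSubsets = concatMap (λ ys → named (lem (Names ys))) (sublists (toList (elements F)))

        properSubsets-sound : ∀ {K} → K ∈ₗ properSubsets → ∃[ G ] G ⊊f F × K ≡ canonical G
        properSubsets-sound K∈
          with find (∈-concatMap⁻ (λ ys → named (lem (Names ys))) {xs = sublists (toList (elements F))} K∈)
        ... | ys , _ , K∈ys = named-sound (lem (Names ys)) K∈ys

        -- The list of G need not be a sublist of that of F, but filtering the latter by membership
        -- in G gives a sublist with the same elements as G.
        properSubsets-complete : ∀ {G} → G ⊊f F → canonical G ∈ₗ properSubsets
        properSubsets-complete {G} G⊊F@(G⊆F , F⊈G) = go (List.filter G? Fs) refl
          where
          Fs : List Carrier
          Fs = toList (elements F)
          G? : ∀ x → Dec (x ∈f G)
          G? = λ x → lem (x ∈f G)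

          in-filter : ∀ {x} → x ∈f G → x M.∈ filter G? Fs
          in-filter {x} x∈ = Mem.∈-filter⁺ S G? (λ y≈z → Mem.∈-resp-≈ S y≈z) (G⊆F {x} x∈) x∈

          of-filter : ∀ {x} → x M.∈ filter G? Fs → x ∈f G
          of-filter x∈ = proj₂ (Mem.∈-filter⁻ S G? (λ y≈z → Mem.∈-resp-≈ S y≈z) {xs = Fs} x∈)

          go : ∀ ys → filter G? Fs ≡ ys → canonical G ∈ₗ properSubsets
          go [] e with subst (List⁺.head (elements G) M.∈_) e (in-filter (here (Setoid.refl S)))
          ... | ()
          go (y ∷ ys) e = subst (_∈ₗ properSubsets) (canon-cong (𝒫f-setoid S) ((λ {x} → G′⊆G {x}) , (λ {x} → G⊆G′ {x})))
            (∈-concatMap⁺ (λ ys → named (lem (Names ys)))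
              (lose (subst (_∈ₗ sublists Fs) e (filter∈sublists G? Fs))
                (named-complete {G = G′} (lem (Names (y ∷ ys))) G′⊊F refl)))
            where
            G′ : 𝒫f S
            G′ = finset (y ∷ ys) (subst (Uniqueₛ S) e (Uniqueₛ.filter⁺ S G? (distinct F)))
            G′⊆G : G′ ⊆f G
            G′⊆G {x} = of-filter ∘ subst (x M.∈_) (sym e)
            G⊆G′ : G ⊆f G′
            G⊆G′ {x} = subst (x M.∈_) e ∘ in-filter
            G′⊊F : G′ ⊊f F
            G′⊊F = (λ {x} → G⊆F {x} ∘ G′⊆G {x}) , λ F⊆G′ → F⊈G λ {x} → G′⊆G {x} ∘ F⊆G′ {x}

  -- Strictly increasing enumerations

  _<⁺_ : ℕ⁺ → ℕ⁺ → Set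
  i <⁺ j = value i < value j

  -- A block may list its indices in any order, while the chain of sets has to be followed upwards.
  record Enumeration (β : 𝒫f ℕ⁺-setoid) : Set where
    field
      least      : ℕ⁺
      rest       : List ℕ⁺
      increasing : AllPairs _<⁺_ (least ∷ rest)
      permutes   : least ∷ rest ↭ toList (elements β)

    sum-≡ : ∀ f → total f (least ∷ rest) ≡ value (∑ β f)
    sum-≡ f = trans (sum-↭ (Perm.map⁺ (value ∘ f) permutes)) (sym (value-∑ β f))

    member : ∀ {i} → i ∈ₗ least ∷ rest → i ∈f β
    member = Perm.∈-resp-↭ permutes

  enumerate : ∀ β → Enumeration β
  enumerate β = go (sort xs) (sort-↭ xs) (sort-↗ xs)
    where
    xs = toList (elements β)
    order : DecTotalOrder 0ℓ 0ℓ 0ℓ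
    order = On.decTotalOrder ℕ.≤-decTotalOrder (value {P = ℕ.NonZero})
    open Sort order using (sort; sort-↭; sort-↗)

    go : ∀ ys → ys ↭ xs → IsSorted (DecTotalOrder.totalOrder order) ys → Enumeration β
    go []       perm _ with () ← Perm.∈-resp-↭ (↭-sym perm) (here refl)
    go (y ∷ ys) perm sorted = record
      { least      = y
      ; rest       = ys
      ; increasing = AllPairs.zipWith (λ (i≤j , i≢j) → ℕ.≤∧≢⇒< i≤j (i≢j ∘ ℕ⁺-≡))
          ( Sorted.Sorted⇒AllPairs (DecTotalOrder.totalOrder order) sorted
          , Permₛ.Unique-resp-↭ ℕ⁺-setoid (↭⇒↭ₛ (↭-sym perm)) (distinct β) )
      ; permutes   = perm
      }

  -- Partial tuples of block sums

  module FromIdempotent (p : Ultra ℕ⁺) (J : ∀ B → T (fam p B) → IsJSet (T ∘ B))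
    (pp≈p : p βℕ⁺.· p βℕ⁺.≈ p) where

    -- The J-set property is applied to the translates t ↦ f(d + 1 + t), and the index set obtained
    -- is then translated by d + 1.
    J-above : ∀ {B} → T (fam p B) → ∀ (F : FunSet) d →
      Σ ℕ⁺ λ a → Σ (𝒫f ℕ⁺-setoid) λ β → d < min β × (∀ f → f ∈f F → T (B (a +⁺ ∑ β f)))
    J-above {B} pB F d = let a , γ , h = J B pB F+ in a , relabel +d-injective γ
      , <-min (relabel +d-injective γ) (λ x∈ → above {γ} (∈-relabel +d-injective γ x∈))
      , λ f f∈ → subst (λ s → T (B (a +⁺ s))) (sym (∑-relabel +d-injective γ f)) (h (f ∘ +d) (shifted f f∈))
      where
      +d : ℕ⁺ → ℕ⁺
      +d = (suc d , [ _ ]) +⁺_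
      +d-injective : ∀ {i j} → +d i ≡ +d j → i ≡ j
      +d-injective e = ℕ⁺-≡ (ℕ.+-cancelˡ-≡ (suc d) _ _ (cong value e))
      F+ : FunSet
      F+ = Functions.fromList⁺ (List⁺.map (_∘ +d) (elements F))
      shifted : ∀ f → f ∈f F → (f ∘ +d) ∈f F+
      shifted f f∈ = Functions.∈-fromList⁺⁺ (List⁺.map (_∘ +d) (elements F))
        (Mem.∈-map⁺ ℕ⁺^ℕ⁺ ℕ⁺^ℕ⁺ {f = _∘ +d} (λ f≗g t → f≗g (+d t)) {xs = toList (elements F)} f∈)
      above : ∀ {γ : 𝒫f ℕ⁺-setoid} {x} → ∃[ y ] y ∈f γ × x ≡ +d y → d < value x
      above (y , _ , refl) = ℕ.m≤m+n (suc d) (value y)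

    -- In a state `opened n A x` a block with sum x has been started, in `closed n A` there is
    -- none; n further blocks are to be appended so as to get a tuple in A.
    data State : Set where
      closed : ∀ n → (Vec ℕ⁺ n → Bool) → State
      opened : ∀ n → (Vec ℕ⁺ (suc n) → Bool) → ℕ⁺ → State

    extendable : ∀ n → (Vec ℕ⁺ (suc n) → Bool) → ℕ⁺ → Bool
    extendable n A x = tensor p n λ xs → A (x ∷ xs)

    -- An open block must have both futures: to end at x, and to be prolonged by p-many y.
    Good : State → Set
    Good (closed n A)   = T (tensor p n A)
    Good (opened n A x) = T (extendable n A x) × T (fam p λ y → extendable n A (x +⁺ y))

    AllGood : List State → Set
    AllGood ss = ∀ s → s ∈ₗ ss → Good s

    enter : ∀ n → (Vec ℕ⁺ (suc n) → Bool) → ℕ⁺ → List State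
    enter n A x = opened n A x ∷ closed n (λ xs → A (x ∷ xs)) ∷ []

    moves : State → ℕ⁺ → List State
    moves (closed zero A)    y = []
    moves (closed (suc n) A) y = enter n A y
    moves (opened n A x)     y = enter n A (x +⁺ y)

    enter-good : ∀ n A x → T (extendable n A x) → T (fam p λ y → extendable n A (x +⁺ y)) → AllGood (enter n A x)
    enter-good n A x a b _ (here refl)         = a , b
    enter-good n A x a b _ (there (here refl)) = a

    -- By p + p = p, a set B in p satisfies -y + B ∈ p for p-many y; this lets the block be
    -- prolonged once more after y.
    moves-good : ∀ s → Good s → T (fam p λ y → ⌊ AllGood (moves s y) ⌋)
    moves-good (closed zero A)    _ = Ultra.up p (λ _ _ → into λ _ ()) (Ultra.whole p)
    moves-good (closed (suc n) A) g = Ultra.meet p {extendable n A} {λ y → fam p λ z → extendable n A (y +⁺ z)}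
      (λ y a b → into (enter-good n A y a b)) g (T-resp (sym (pp≈p _)) g)
    moves-good (opened n A x) (_ , g) = Ultra.meet p
      {λ y → extendable n A (x +⁺ y)} {λ y → fam p λ z → extendable n A (x +⁺ (y +⁺ z))}
      (λ y a b → into (enter-good n A (x +⁺ y) a
        (T-resp (fam-cong p λ z → cong (extendable n A) (sym (+⁺-assoc x y z))) b)))
      g (T-resp (sym (pp≈p _)) g)

    all-moves-good : ∀ ss → AllGood ss → T (fam p λ y → ⌊ (∀ s → s ∈ₗ ss → AllGood (moves s y)) ⌋)
    all-moves-good []       _ = Ultra.up p (λ _ _ → into λ _ ()) (Ultra.whole p)
    all-moves-good (s ∷ ss) g = Ultra.meet p
      (λ y a b → into λ { _  (here refl) → out a
                        ; s′ (there s′∈) → out {P = ∀ s → s ∈ₗ ss → AllGood (moves s y)} b s′ s′∈ })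
      (moves-good s (g s (here refl))) (all-moves-good ss λ s′ → g s′ ∘ there)

    -- Construction of α and H by recursion on the size of a set

    module Construction {m} (A : Vec ℕ⁺ m → Bool) (A∈ : T (tensor p m A)) where

      -- `reach` collects finitely many states that later choices must keep good, so that goodness
      -- amounts to finitely many conditions.
      record Datum : Set where
        field
          offset  : ℕ⁺
          indices : 𝒫f ℕ⁺-setoid
          reach   : List State
      open Datum

      sumAt : ℕ⁺ × 𝒫f ℕ⁺-setoid → (ℕ⁺ → ℕ⁺) → ℕ⁺
      sumAt (a , β) f = a +⁺ ∑ β f

      before : List Datum → List State
      before ds = closed m A ∷ concatMap reach ds

      Suitable : FunSet → List Datum → ℕ⁺ × 𝒫f ℕ⁺-setoid → Set
      Suitable F ds c = (∀ d → d ∈ₗ ds → max (indices d) < min (proj₂ c))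
        × (∀ f → f ∈f F → ∀ s → s ∈ₗ before ds → AllGood (moves s (sumAt c f)))

      -- The states so far are finitely many and good, so the y keeping all their moves good form a
      -- member of p, hence a J-set. The bound places the new index set above all earlier ones.
      suitable : ∀ F ds → AllGood (before ds) → Σ _ (Suitable F ds)
      suitable F ds good = let a , β , above , h = J-above (all-moves-good (before ds) good) F (bound ds) in
        (a , β) , (λ d d∈ → ℕ.≤-<-trans (≤-bound ds d∈) above) , λ f f∈ → out (h f f∈)
        where
        bound : List Datum → ℕ
        bound []       = 0
        bound (d ∷ ds) = max (indices d) ℕ.⊔ bound ds
        ≤-bound : ∀ ds {d} → d ∈ₗ ds → max (indices d) ≤ bound ds
        ≤-bound (d ∷ ds) (here refl) = ℕ.m≤m⊔n _ _
        ≤-bound (d ∷ ds) (there d∈)  = ℕ.≤-trans (≤-bound ds d∈) (ℕ.m≤n⊔m (max (indices d)) _)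

      opaque
        choice : FunSet → List Datum → ℕ⁺ × 𝒫f ℕ⁺-setoid
        choice F ds with lem (Σ _ (Suitable F ds))
        ... | yes (c , _) = c
        -- A default for lists with bad states, so that goodness can be proved after the recursion
        -- instead of along with it.
        ... | no _        = 1⁺ , Naturals.singleton 1⁺

        choice-suitable : ∀ F ds → AllGood (before ds) → Suitable F ds (choice F ds)
        choice-suitable F ds good with lem (Σ _ (Suitable F ds))
        ... | yes (_ , suit) = suit
        ... | no ¬suit       = ⊥-elim (¬suit (suitable F ds good))

      after : FunSet → List Datum → List State
      after F ds = concatMap (λ s → concatMap (λ f → moves s (sumAt (choice F ds) f)) (toList (elements F))) (before ds)

      new : FunSet → List Datum → Datum
      new F ds = record
        { offset  = proj₁ (choice F ds)
        ; indices = proj₂ (choice F ds)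
        ; reach   = before ds ++ after F ds
        }

      new-good : ∀ F ds → AllGood (before ds) → AllGood (reach (new F ds))
      new-good F ds good s s∈ with ∈-++⁻ (before ds) s∈
      ... | inj₁ s∈b = good s s∈b
      ... | inj₂ s∈a with find (∈-concatMap⁻ _ {xs = before ds} s∈a)
      ...   | r , r∈ , s∈r with find (∈-concatMap⁻ _ {xs = toList (elements F)} s∈r)
      ...     | f , f∈ , s∈f = proj₂ (choice-suitable F ds good) f (Any.map (λ { refl _ → refl }) f∈) r r∈ s s∈f

      moves∈after : ∀ F ds {f s s′} → f ∈f F → s ∈ₗ before ds → s′ ∈ₗ moves s (sumAt (choice F ds) f) → s′ ∈ₗ after F ds
      moves∈after F ds {f} {s} {s′} f∈ s∈ s′∈ with find f∈
      ... | g , g∈ , f≗g = ∈-concatMap⁺ _ (lose s∈ (∈-concatMap⁺ _ (lose g∈ (subst (λ y → s′ ∈ₗ moves s y)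
        (cong (proj₁ (choice F ds) +⁺_) (∑-cong (proj₂ (choice F ds)) f≗g)) s′∈))))

      before-good : ∀ ds → (∀ d → d ∈ₗ ds → AllGood (reach d)) → AllGood (before ds)
      before-good ds good s (here refl) = A∈
      before-good ds good s (there s∈) with find (∈-concatMap⁻ reach {xs = ds} s∈)
      ... | d , d∈ , s∈d = good d d∈ s s∈d

      rank : FunSet → ℕ
      rank = size ℕ⁺^ℕ⁺

      smaller : FunSet → List FunSet
      smaller = properSubsets ℕ⁺^ℕ⁺

      canonical-⊊ : ∀ {F G} → F ⊊f G → canonical ℕ⁺^ℕ⁺ F ⊊f G
      canonical-⊊ {F} (F⊆G , G⊈F) = (λ {f} → F⊆G {f} ∘ canonical-⊆ ℕ⁺^ℕ⁺ F {f})
        , λ G⊆ → G⊈F λ {f} → canonical-⊆ ℕ⁺^ℕ⁺ F {f} ∘ G⊆ {f}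

      smaller-rank : ∀ F {K} → K ∈ₗ smaller F → rank K < rank F
      smaller-rank F K∈ with properSubsets-sound ℕ⁺^ℕ⁺ F K∈
      ... | G , G⊊F , refl = ⊊⇒size-< ℕ⁺^ℕ⁺ (canonical ℕ⁺^ℕ⁺ G) F (canonical-⊊ {G} {F} G⊊F)

      -- The number bounds the depth of a recursion over proper subsets. As sizes drop, every bound
      -- from `rank F` on gives the same value, by `table-stable`.
      table : ℕ → FunSet → Datum
      table zero    F = new F []
      table (suc n) F = new F (List.map (table n) (smaller F))

      table-stable : ∀ n k F → rank F ≤ n → rank F ≤ k → table n F ≡ table k F
      table-stable (suc n) (suc k) F F≤n F≤k = cong (new F) (map-cong-local (All.tabulate λ {K} K∈ →
        table-stable n k K (ℕ.≤-pred (ℕ.≤-trans (smaller-rank F K∈) F≤n)) (ℕ.≤-pred (ℕ.≤-trans (smaller-rank F K∈) F≤k))))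

      datum : FunSet → Datum
      datum F = table (rank F) F

      predecessors : FunSet → List Datum
      predecessors F = List.map datum (smaller F)

      datum-new : ∀ F → datum F ≡ new F (predecessors F)
      datum-new F = cong (new F) (map-cong-local (All.tabulate λ {K} K∈ →
        table-stable _ (rank K) K (ℕ.≤-pred (smaller-rank F K∈)) ℕ.≤-refl))

      table-good : ∀ n F → rank F ≤ n → AllGood (reach (table n F))
      table-good (suc n) F F≤n = new-good F ds (before-good ds λ d d∈ → good (∈-map⁻ (table n) d∈))
        where
        ds = List.map (table n) (smaller F)
        good : ∀ {d} → ∃[ K ] K ∈ₗ smaller F × d ≡ table n K → AllGood (reach d)
        good (K , K∈ , refl) = table-good n K (ℕ.≤-pred (ℕ.≤-trans (smaller-rank F K∈) F≤n))

      predecessors-good : ∀ F → AllGood (before (predecessors F))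
      predecessors-good F = before-good (predecessors F) λ d d∈ → good (∈-map⁻ datum d∈)
        where
        good : ∀ {d} → ∃[ K ] K ∈ₗ smaller F × d ≡ datum K → AllGood (reach d)
        good (K , _ , refl) = table-good (rank K) K ℕ.≤-refl

      datumᶜ : FunSet → Datum
      datumᶜ F = datum (canonical ℕ⁺^ℕ⁺ F)

      predecessorsᶜ : FunSet → List Datum
      predecessorsᶜ F = predecessors (canonical ℕ⁺^ℕ⁺ F)

      ⊊⇒predecessor : ∀ F G → F ⊊f G → datumᶜ F ∈ₗ predecessorsᶜ G
      ⊊⇒predecessor F G (F⊆G , G⊈F) = ∈-map⁺ datum (properSubsets-complete ℕ⁺^ℕ⁺ (canonical ℕ⁺^ℕ⁺ G) {F}
        ( (λ {f} → ⊆-canonical ℕ⁺^ℕ⁺ G {f} ∘ F⊆G {f})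
        , λ G⊆F → G⊈F λ {f} → G⊆F {f} ∘ ⊆-canonical ℕ⁺^ℕ⁺ G {f} ))

      α : FunSet → ℕ⁺
      α F = offset (datumᶜ F)

      H : FunSet → 𝒫f ℕ⁺-setoid
      H F = indices (datumᶜ F)

      choiceᶜ : FunSet → ℕ⁺ × 𝒫f ℕ⁺-setoid
      choiceᶜ F = choice (canonical ℕ⁺^ℕ⁺ F) (predecessorsᶜ F)

      H≡ : ∀ F → H F ≡ proj₂ (choiceᶜ F)
      H≡ F = cong indices (datum-new (canonical ℕ⁺^ℕ⁺ F))

      α≡ : ∀ F → α F ≡ proj₁ (choiceᶜ F)
      α≡ F = cong offset (datum-new (canonical ℕ⁺^ℕ⁺ F))

      datumᶜ-cong : ∀ {F G} → F ≈f G → datumᶜ F ≡ datumᶜ G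
      datumᶜ-cong F≈G = cong datum (canon-cong (𝒫f-setoid ℕ⁺^ℕ⁺) F≈G)

      H-increasing : ∀ F G → F ⊊f G → max (H F) < min (H G)
      H-increasing F G F⊊G = subst (λ β → max (H F) < min β) (sym (H≡ G))
        (proj₁ (choice-suitable (canonical ℕ⁺^ℕ⁺ G) (predecessorsᶜ G) (predecessors-good (canonical ℕ⁺^ℕ⁺ G)))
          (datumᶜ F) (⊊⇒predecessor F G F⊊G))

      term : FunSet → (ℕ⁺ → ℕ⁺) → ℕ⁺
      term F f = α F +⁺ ∑ (H F) f

      beforeᶜ : FunSet → List State
      beforeᶜ F = before (predecessorsᶜ F)

      reach⊆before : ∀ F G → F ⊊f G → ∀ {s} → s ∈ₗ reach (new (canonical ℕ⁺^ℕ⁺ F) (predecessorsᶜ F)) → s ∈ₗ beforeᶜ G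
      reach⊆before F G F⊊G {s} s∈ = there (∈-concatMap⁺ reach (lose (⊊⇒predecessor F G F⊊G)
        (subst (λ d → s ∈ₗ reach d) (sym (datum-new (canonical ℕ⁺^ℕ⁺ F))) s∈)))

      before-moves : ∀ F G → F ⊊f G → ∀ {f s s′} → f ∈f F → s ∈ₗ beforeᶜ F → s′ ∈ₗ moves s (term F f) → s′ ∈ₗ beforeᶜ G
      before-moves F G F⊊G {f} {s} {s′} f∈ s∈ s′∈ = reach⊆before F G F⊊G (∈-++⁺ʳ (beforeᶜ F)
        (moves∈after (canonical ℕ⁺^ℕ⁺ F) (predecessorsᶜ F) (⊆-canonical ℕ⁺^ℕ⁺ F {f} f∈) s∈
          (subst (λ y → s′ ∈ₗ moves s y) (cong₂ (λ a β → a +⁺ ∑ β f) (α≡ F) (H≡ F)) s′∈)))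

      -- Following a chain through its blocks

      module _ (G : ℕ⁺ → FunSet) (climb : ∀ i → G i ⊊f G (i +⁺ 1⁺)) (f : ℕ⁺ → ℕ⁺ → ℕ⁺) (f∈G : ∀ i → f i ∈f G i) where

        y : ℕ⁺ → ℕ⁺
        y i = term (G i) (f i)

        climb-by : ∀ n i → G i ⊊f G (i +⁺ (suc n , [ _ ]))
        climb-by zero    i = climb i
        climb-by (suc n) i = ⊊f-trans {E = G i} {G (i +⁺ 1⁺)} {G (i +⁺ (suc (suc n) , [ _ ]))} (λ {g} → proj₁ (climb i) {g})
          (subst (λ j → G (i +⁺ 1⁺) ⊊f G j) (+⁺-assoc i 1⁺ (suc n , [ _ ])) (climb-by n (i +⁺ 1⁺)))

        climb-< : ∀ i j → i <⁺ j → G i ⊊f G j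
        climb-< i j i<j with ℕ.m≤n⇒∃[o]m+o≡n i<j
        ... | n , i+n≡j = subst (λ k → G i ⊊f G k) (ℕ⁺-≡ (trans (ℕ.+-suc (value i) n) i+n≡j)) (climb-by n i)

        AvailableAt : ℕ⁺ → State → Set
        AvailableAt i s = s ∈ₗ beforeᶜ (G i)

        -- All later j are covered because the next index of a block may lie anywhere beyond i; each
        -- set of the chain precedes every later one in the recursion.
        AvailableAfter : ℕ⁺ → State → Set
        AvailableAfter i s = ∀ j → i <⁺ j → AvailableAt j s

        Entered : ∀ n → (Vec ℕ⁺ (suc n) → Bool) → ℕ⁺ → ℕ⁺ → Set
        Entered n B x i = ∀ s → s ∈ₗ enter n B x → AvailableAfter i s

        move : ∀ {i s s′} → AvailableAt i s → s′ ∈ₗ moves s (y i) → AvailableAfter i s′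
        move {i} s∈ s′∈ j i<j = before-moves (G i) (G j) (climb-< i j i<j) (f∈G i) s∈ s′∈

        continue : ∀ {n B} x i js → AllPairs _<⁺_ (i ∷ js) → Entered n B x i →
          ∃[ z ] ∃[ l ] l ∈ₗ i ∷ js × value z ≡ value x ℕ.+ total y js × Entered n B z l
        continue x i [] _ E = x , i , here refl , sym (ℕ.+-identityʳ _) , E
        continue x i (j ∷ js) ((i<j ∷ _) ∷ inc) E =
          let z , l , l∈ , z≡ , E′ = continue (x +⁺ y j) j js inc λ s s∈ → move (E _ (here refl) j i<j) s∈
          in z , l , there l∈ , trans z≡ (ℕ.+-assoc (value x) (value (y j)) _) , E′

        -- Later blocks lie above every index of β, so `l ∈f β` is enough to place them after l.
        block : ∀ {n B} (β : 𝒫f ℕ⁺-setoid) → (∀ {i} → i ∈f β → AvailableAt i (closed (suc n) B)) →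
          ∃[ l ] l ∈f β × AvailableAfter l (closed n λ xs → B (∑ β y ∷ xs))
        block {n} {B} β avail =
          let z , l , l∈ , z≡ , E = continue (y least) least rest increasing λ s s∈ → move (avail (member (here refl))) s∈
          in l , member l∈ , subst (λ x → AvailableAfter l (closed n λ xs → B (x ∷ xs)))
               (ℕ⁺-≡ (trans z≡ (sum-≡ y))) (E _ (there (here refl)))
          where open Enumeration (enumerate β)

        tuple : ∀ n B (β : Fin n → 𝒫f ℕ⁺-setoid) → (∀ i j → i Fin.< j → β i <f β j) → Good (closed n B) →
          (∀ j {i} → i ∈f β j → AvailableAt i (closed n B)) → T (B (tabulate λ j → ∑ (β j) y))
        tuple zero    B β β-< good avail = good
        tuple (suc n) B β β-< good avail =
          let l , l∈ , after-l = block {n} {B} (β zero) (avail zero) in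
          tuple n _ (β ∘ suc) (λ i j i<j → β-< (suc i) (suc j) (ℕ.s<s i<j))
            -- Every state available at some set of the chain is good; the index after l provides
            -- such a set.
            (predecessors-good (canonical ℕ⁺^ℕ⁺ (G (l +⁺ 1⁺))) _ (after-l (l +⁺ 1⁺) (ℕ.m<m+n (value l) ℕ.z<s)))
            (λ j i∈ → after-l _ (<f-elim {β zero} {β (suc j)} (β-< zero (suc j) ℕ.z<s) l∈ i∈))

      sums∈A : ∀ (G : ℕ⁺ → FunSet) → (∀ i → G i ⊊f G (i +⁺ 1⁺)) →
        ∀ (β : Fin m → 𝒫f ℕ⁺-setoid) → (∀ {i j} → i Fin.< j → β i <f β j) →
        ∀ (f : ℕ⁺ → ℕ⁺ → ℕ⁺) → (∀ i → f i ∈f G i) →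
        T (A (tabulate λ j → ∑[ i ∈ β j ] term (G i) (f i)))
      sums∈A G climb β β-< f f∈G = tuple G climb f f∈G m A β (λ i j → β-< {i} {j}) A∈ λ _ _ → here refl

  -- Predicate-valued and Boolean-valued ultrafilters

  module _ {X : Set} where

    fromUltra : Ultra X → Ultrafilter X
    fromUltra p = record
      { family    = λ A → T (fam p λ x → ⌊ A x ⌋)
      ; whole     = up (λ _ _ → into _) whole
      ; proper    = λ a → out (proj₂ (inhabited a))
      ; upward    = λ A⊆B → up λ _ → into ∘ A⊆B ∘ out
      ; intersect = meet λ _ a b → into (out a , out b)
      ; ultra     = λ A → Sum.map₂ (up λ _ n → into (not-elim n ∘ into)) (ultra λ x → ⌊ A x ⌋)
      }
      where open Ultra p

    toUltra : Ultrafilter X → Ultra X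
    toUltra p = record
      { fam      = λ A → ⌊ (T ∘ A) ∈ᵘ p ⌋
      ; isFilter = record
        { whole     = into (upward _ whole)
        ; inhabited = λ a → by-contradiction λ ¬x → proper (upward (λ {x} Ax → ¬x (x , Ax)) (out a))
        ; up        = λ A⊆B a → into (upward (λ {x} → A⊆B x) (out a))
        ; meet      = λ A∩B⊆C a b → into (upward (λ {x} (Ax , Bx) → A∩B⊆C x Ax Bx) (intersect (out a) (out b)))
        }
      ; ultra    = λ A → Sum.map into (into ∘ upward not-intro) (ultra (T ∘ A))
      }
      where open Ultrafilter p

  -- Tensor powers with the first coordinate split off

  module _ (p : Ultrafilter ℕ⁺) where
    open Ultrafilter p

    tensorᵘ : ∀ n → Pred (Vec ℕ⁺ n) 0ℓ → Set
    tensorᵘ zero    A = A []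
    tensorᵘ (suc n) A = (λ x → tensorᵘ n λ xs → A (x ∷ xs)) ∈ᵘ p

    -- Since (x ∷ xs) ∷ʳ y computes to x ∷ (xs ∷ʳ y), an induction under the first quantifier moves
    -- the splitting point to the last coordinate.
    tensorᵘ-∷ʳ⁺ : ∀ n {A : Pred (Vec ℕ⁺ (suc n)) 0ℓ} →
      tensorᵘ (suc n) A → tensorᵘ n λ xs → (λ x → A (xs ∷ʳ x)) ∈ᵘ p
    tensorᵘ-∷ʳ⁺ zero        = id
    tensorᵘ-∷ʳ⁺ (suc n) {A} = upward λ {x} → tensorᵘ-∷ʳ⁺ n {λ xs → A (x ∷ xs)}

    tensorᵘ-∷ʳ⁻ : ∀ n {A : Pred (Vec ℕ⁺ (suc n)) 0ℓ} →
      tensorᵘ n (λ xs → (λ x → A (xs ∷ʳ x)) ∈ᵘ p) → tensorᵘ (suc n) A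
    tensorᵘ-∷ʳ⁻ zero        = id
    tensorᵘ-∷ʳ⁻ (suc n) {A} = upward λ {x} → tensorᵘ-∷ʳ⁻ n {λ xs → A (x ∷ xs)}

    ⨂⇒tensorᵘ : ∀ k {A} → A ∈ᵘ ⨂ {k} (λ _ → p) → tensorᵘ (suc k) A
    ⨂⇒tensorᵘ zero        = id
    ⨂⇒tensorᵘ (suc k) {A} = tensorᵘ-∷ʳ⁻ (suc k) {A} ∘ ⨂⇒tensorᵘ k

    tensorᵘ⇒⨂ : ∀ k {A} → tensorᵘ (suc k) A → A ∈ᵘ ⨂ {k} (λ _ → p)
    tensorᵘ⇒⨂ zero        = id
    tensorᵘ⇒⨂ (suc k) {A} = tensorᵘ⇒⨂ k ∘ tensorᵘ-∷ʳ⁺ (suc k) {A}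

    toUltra-tensor : ∀ n {A} → tensorᵘ n A → T (tensor (toUltra p) n λ xs → ⌊ A xs ⌋)
    toUltra-tensor zero    = into
    toUltra-tensor (suc n) = into ∘ upward (toUltra-tensor n)

  fromUltra-tensor : ∀ p n {A} → T (tensor p n λ xs → ⌊ A xs ⌋) → tensorᵘ (fromUltra p) n A
  fromUltra-tensor p zero    = out
  fromUltra-tensor p (suc n) = Ultra.up p λ _ → into ∘ fromUltra-tensor p n

  fromUltra-idempotent : ∀ p → p βℕ⁺.· p βℕ⁺.≈ p → Idempotent (fromUltra p)
  fromUltra-idempotent p pp≈p =
      (λ {A} a → T-resp (pp≈p _) (Ultra.up p (λ _ → out) a))
    , (λ {A} a → Ultra.up p (λ _ → into) (T-resp (sym (pp≈p _)) a))

  toUltra-idempotent : ∀ p → Idempotent p → toUltra p βℕ⁺.· toUltra p βℕ⁺.≈ toUltra p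
  toUltra-idempotent p (pp⊆p , p⊆pp) A = T-ext
    (λ a → into (pp⊆p (upward out (out a))))
    (λ a → into (upward into (p⊆pp (out a))))
    where open Ultrafilter p

  fromUltra-𝒥 : ∀ p → (∀ B → T (fam p B) → IsJSet (T ∘ B)) → 𝒥 (fromUltra p)
  fromUltra-𝒥 p J A A∈p F = let a , β , h = J (λ x → ⌊ A x ⌋) A∈p F in a , β , λ f f∈ → out (h f f∈)

  toUltra-𝒥 : ∀ p → 𝒥 p → ∀ B → T (fam (toUltra p) B) → IsJSet (T ∘ B)
  toUltra-𝒥 p J B B∈p = J (T ∘ B) (out B∈p)

  -- The two implications

  SumsIn : ∀ {m} → Pred (Vec ℕ⁺ m) 0ℓ → (FunSet → ℕ⁺) → (FunSet → 𝒫f ℕ⁺-setoid) → Set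
  SumsIn {m} A α H = ∀ (G : ℕ⁺ → FunSet) → (∀ i → G i ⊊f G (i +⁺ 1⁺)) →
    ∀ (β : Fin m → 𝒫f ℕ⁺-setoid) → (∀ {i j} → i Fin.< j → β i <f β j) →
    ∀ (f : ℕ⁺ → ℕ⁺ → ℕ⁺) → (∀ i → f i ∈f G i) →
    tabulate (λ j → ∑[ i ∈ β j ] (α (G i) +⁺ (∑[ t ∈ H (G i) ] f i t))) ∈ A

  module _ (k : ℕ) (A : Pred (Vec ℕ⁺ (suc k)) 0ℓ) where

    choices⇒ultrafilter : ∀ (α : FunSet → ℕ⁺) H → (∀ F G → F ⊊f G → max (H F) < min (H G)) → SumsIn A α H →
      Σ βℕ λ p → p ∈ 𝒥 × Idempotent p × A ∈ᵘ ⨂ {k} (λ _ → p)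
    choices⇒ultrafilter α H H-increasing sums∈A =
        fromUltra point
      , fromUltra-𝒥 point (λ B B∈p F → point-J F B B∈p)
      , fromUltra-idempotent point point-idem
      , tensorᵘ⇒⨂ (fromUltra point) k (fromUltra-tensor point (suc k) {A}
          (A∈tensor (λ xs → ⌊ A xs ⌋) λ G climb β β-< f f∈G → into (sums∈A G climb β β-< f f∈G)))
      where
      open FromChoices α H H-increasing
      open βℕ⁺.MinimalIdempotent minIdem
      open Realisation α H H-increasing

    ultrafilter⇒choices : ∀ p → p ∈ 𝒥 → Idempotent p → A ∈ᵘ ⨂ {k} (λ _ → p) →
      Σ (Func (𝒫f-setoid ℕ⁺^ℕ⁺) ℕ⁺-setoid) λ α → Σ (Func (𝒫f-setoid ℕ⁺^ℕ⁺) (𝒫f-setoid ℕ⁺-setoid)) λ H →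
      (∀ F G → F ⊊f G → max (H ⟨$⟩ F) < min (H ⟨$⟩ G)) × SumsIn A (α ⟨$⟩_) (H ⟨$⟩_)
    ultrafilter⇒choices p p∈𝒥 idem A∈ =
        record { to = α ; cong = λ F≈G → cong Datum.offset (datumᶜ-cong F≈G) }
      , record { to = H ; cong = λ F≈G → reflexive (cong Datum.indices (datumᶜ-cong F≈G)) }
      , H-increasing
      , λ G climb β β-< f f∈G → out (sums∈A G climb β β-< f f∈G)
      where
      A∈tensor : T (tensor (toUltra p) (suc k) λ xs → ⌊ A xs ⌋)
      A∈tensor = toUltra-tensor p (suc k) {A} (⨂⇒tensorᵘ p k A∈)
      open FromIdempotent (toUltra p) (toUltra-𝒥 p p∈𝒥) (toUltra-idempotent p idem)
      open Construction (λ xs → ⌊ A xs ⌋) A∈tensor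
      open Setoid (𝒫f-setoid ℕ⁺-setoid) using (reflexive)

corollary1p24 :
  AxiomOfChoice →
  ∀ (k : ℕ) → let m = suc k in
  ∀ (A : Pred (Vec ℕ⁺ m) 0ℓ) →
  (Σ (Func (𝒫f-setoid ℕ⁺^ℕ⁺) ℕ⁺-setoid) λ α →
   Σ (Func (𝒫f-setoid ℕ⁺^ℕ⁺) (𝒫f-setoid ℕ⁺-setoid)) λ H →
     (∀ F G → F ⊊f G → max (H ⟨$⟩ F) < min (H ⟨$⟩ G))
     ×
     (∀ (G : ℕ⁺ → 𝒫f ℕ⁺^ℕ⁺) → (∀ i → G i ⊊f G (i +⁺ 1⁺)) →
      ∀ (β : Fin m → 𝒫f ℕ⁺-setoid) → (∀ {i j} → i Fin.< j → β i <f β j) →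
      ∀ (f : ℕ⁺ → ℕ⁺ → ℕ⁺) → (∀ i → f i ∈f G i) →
      tabulate (λ j → ∑[ i ∈ β j ] ((α ⟨$⟩ G i) +⁺ (∑[ t ∈ H ⟨$⟩ G i ] f i t))) ∈ A))
  ⇔
  (Σ βℕ λ p → p ∈ 𝒥 × Idempotent p × A ∈ᵘ ⨂ {k} (λ _ → p))
corollary1p24 ac k A = mk⇔
  (λ (α , H , H-increasing , sums∈A) → choices⇒ultrafilter k A (α ⟨$⟩_) (H ⟨$⟩_) H-increasing sums∈A)
  (λ (p , p∈𝒥 , idem , A∈⨂p) → ultrafilter⇒choices k A p p∈𝒥 idem A∈⨂p)
  where open WithChoice ac
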